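{- If $\mathfrak{s} \leq \mathfrak{a}$, then there is a completely separable maximal almost disjoint family $\mathcal{A} \subset [\omega]^{\omega}$.
   Context: $\mathcal{P}(\omega)$ is the power set of $\omega$ and $[\omega]^{\omega}$ is the set of infinite subsets of $\omega$; $a \subset^{*} b$ means that $a \setminus b$ is finite. Two infinite subsets $a, b$ of $\omega$ are almost disjoint (a.d.) if $a \cap b$ is finite. A family $\mathcal{A}$ of infinite subsets of $\omega$ is almost disjoint (a.d.) if its members are pairwise almost disjoint. A maximal almost disjoint (MAD) family is an infinite a.d. family that is not properly contained in a larger a.d. family. For an a.d. family $\mathcal{A}$, $\mathcal{I}(\mathcal{A})$ is the ideal on $\omega$ generated by $\mathcal{A}$: $a \in \mathcal{I}(\mathcal{A})$ iff there are $a_0, \dots, a_k \in \mathcal{A}$ with $a \subset^{*} a_0 \cup \dots \cup a_k$. Put $\mathcal{I}^{+}(\mathcal{A}) = \mathcal{P}(\omega) \setminus \mathcal{I}(\mathcal{A})$. An a.d. family $\mathcal{A} \subset [\omega]^{\omega}$ is completely separable if for every $b \in \mathcal{I}^{+}(\mathcal{A})$ there is $a \in \mathcal{A}$ with $a \subset b$. Cardinal invariants: $\mathfrak{a}$ is the least cardinality of a MAD family. A set $x \subset \omega$ splits $a \subset \omega$ if both $a \cap x$ and $a \setminus x$ are infinite; $\mathcal{F} \subset \mathcal{P}(\omega)$ is a splitting family if every $a \in [\omega]^{\omega}$ is split by some $x \in \mathcal{F}$; $\mathfrak{s}$ is the least cardinality of a splitting family. The ambient theory is ZFC. -}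

module Defs where

open import Axiom.ExcludedMiddle using (ExcludedMiddle)
open import Data.Bool using (Bool; T; _∧_; _∨_; not)
open import Data.List using (List)
import Data.List.Membership.Propositional as List
open import Data.List.NonEmpty using (List⁺; foldr₁)
open import Data.List.NonEmpty.Relation.Unary.All using (All)
open import Data.Nat using (ℕ)
open import Data.Product using (∃; _×_)
open import Function using (_↣_; _↔_)
open import Level using (Level)
open import Relation.Binary.PropositionalEquality using (_≢_)
open import Relation.Nullary using (¬_)
open import Relation.Nullary.Decidable using (decidable-stable)

private variable
  a b : Level
  X : Set

-- Excluded middle for all types (not only for propositions) yields the axiom
-- of choice: a family of non-empty types has a choice function.
excludedMiddle⇒choice : ∀ {A : Set a} {B : A → Set b} → ExcludedMiddle b →
                        (∀ x → ¬ ¬ B x) → ∀ x → B x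
excludedMiddle⇒choice em nonempty x = decidable-stable em (nonempty x)

-- Subsets are characteristic functions.  Under excluded middle every predicate
-- has one, and under function extensionality subsets with the same elements
-- are equal, so _≡_ is the set-theoretic equality on 𝒫 X.
𝒫 : Set → Set
𝒫 X = X → Bool

infix 4 _∈_ _⊆_ _⊂_ _⊆*_
infixr 7 _∩_
infixr 6 _∪_
infixl 7 _∖_

_∈_ : X → 𝒫 X → Set
x ∈ s = T (s x)

_⊆_ : 𝒫 X → 𝒫 X → Set
s ⊆ t = ∀ {x} → x ∈ s → x ∈ t

_⊂_ : 𝒫 X → 𝒫 X → Set
s ⊂ t = s ⊆ t × ¬ (t ⊆ s)

_∩_ _∪_ _∖_ : 𝒫 X → 𝒫 X → 𝒫 X
(s ∩ t) x = s x ∧ t x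
(s ∪ t) x = s x ∨ t x
(s ∖ t) x = s x ∧ not (t x)

Finite : 𝒫 X → Set
Finite {X} s = ∃ λ (xs : List X) → ∀ {x} → x ∈ s → x List.∈ xs

Infinite : 𝒫 X → Set
Infinite s = ¬ Finite s

-- Membership is proof-irrelevant, so the elements of s are counted once each.
Elements : 𝒫 X → Set
Elements s = ∃ λ x → x ∈ s

_⊆*_ : 𝒫 X → 𝒫 X → Set
s ⊆* t = Finite (s ∖ t)

Family : Set
Family = 𝒫 (𝒫 ℕ)

AlmostDisjoint : Family → Set
AlmostDisjoint 𝒜 =
  (∀ {s} → s ∈ 𝒜 → Infinite s) ×
  (∀ {s t} → s ∈ 𝒜 → t ∈ 𝒜 → s ≢ t → Finite (s ∩ t))

MaximalAlmostDisjoint : Family → Set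
MaximalAlmostDisjoint 𝒜 =
  Infinite 𝒜 × AlmostDisjoint 𝒜 ×
  ¬ (∃ λ ℬ → AlmostDisjoint ℬ × 𝒜 ⊂ ℬ)

_∈ℐ_ : 𝒫 ℕ → Family → Set
s ∈ℐ 𝒜 = ∃ λ (ts : List⁺ (𝒫 ℕ)) → All (_∈ 𝒜) ts × s ⊆* foldr₁ _∪_ ts

_∈ℐ⁺_ : 𝒫 ℕ → Family → Set
s ∈ℐ⁺ 𝒜 = ¬ (s ∈ℐ 𝒜)

CompletelySeparable : Family → Set
CompletelySeparable 𝒜 =
  AlmostDisjoint 𝒜 ×
  (∀ t → t ∈ℐ⁺ 𝒜 → ∃ λ s → s ∈ 𝒜 × s ⊆ t)

_Splits_ : 𝒫 ℕ → 𝒫 ℕ → Set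
x Splits s = Infinite (s ∩ x) × Infinite (s ∖ x)

Splitting : Family → Set
Splitting ℱ = ∀ s → Infinite s → ∃ λ x → x ∈ ℱ × x Splits s

-- A cardinal is represented by any type of that cardinality; κ ≤ λ is the
-- existence of an injection κ ↣ λ.
IsLeastCardinality : (Family → Set) → Set → Set
IsLeastCardinality P κ =
  (∃ λ ℱ → P ℱ × (Elements ℱ ↔ κ)) ×
  (∀ ℱ → P ℱ → κ ↣ Elements ℱ)

Is𝔞 : Set → Set
Is𝔞 = IsLeastCardinality MaximalAlmostDisjoint

Is𝔰 : Set → Set
Is𝔰 = IsLeastCardinality Splitting

-- A splitting family of size 𝔰 yields an (ω,ω)-splitting one: for every
-- sequence of infinite sets aₙ some member y has infinitely many aₙ ∩ y
-- infinite and infinitely many aₙ ∖ y infinite.  If the given family is not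
-- already (ω,ω)-splitting, the failing sequence produces from it an undominated
-- family of functions; unions of the interval blocks that these define, with
-- the indices of the blocks chosen by the splitting family, do the job.
--
-- Let y_k (k < κ) be (ω,ω)-splitting and 𝒜 almost disjoint.  Every 𝒜-positive
-- set b is divided by some y_k into two positive sets.  Taking the first such k
-- and iterating along f ∈ 2^ω gives a decreasing sequence of positive sets and
-- a node σ_f ∈ 2^{<κ}, and different f give incompatible nodes.  In a
-- recursion along an enumeration of 𝒫(ω) of minimal length, fewer than 2^ω
-- members, each following its own node, are present, so some σ_f is extended by
-- none of their nodes.  The sequence has a positive pseudointersection e, and e
-- is almost contained in each side prescribed by σ_f up to finitely many members
-- of 𝒜.  Together with the members whose node is a restriction of σ_f these are
-- fewer than 𝔞, since 𝔰 ≤ 𝔞, so some infinite a ⊆ e is almost disjoint from all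
-- of them.  It follows σ_f, hence is almost disjoint from the remaining members,
-- whose nodes are incompatible with σ_f.

module Submission where

open import Defs
open import Axiom.ExcludedMiddle using (ExcludedMiddle)
open import Axiom.Extensionality.Propositional using (Extensionality)
open import Data.Bool using (Bool; true; false; T; not)
open import Data.Bool.Properties using (T-irrelevant; T-∧; T-∨; ¬-not)
open import Data.Empty using (⊥; ⊥-elim)
open import Data.List as List using (List; []; _∷_; _++_; upTo; cartesianProductWith)
open import Data.List.Membership.Propositional.Properties
  using (∈-++⁺ˡ; ∈-++⁺ʳ; ∈-map⁺; ∈-upTo⁺; ∈-cartesianProductWith⁺)
import Data.List.Membership.Propositional as List
open import Data.List.Relation.Unary.Any as Any using (Any; here; there)
open import Data.List.Relation.Unary.Any.Properties using (++⁺ʳ; map⁺)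
open import Data.List.NonEmpty using (_∷_; foldr₁)
open import Data.List.NonEmpty.Relation.Unary.All using (_∷_)
import Data.List.Relation.Unary.All as All
open import Data.List.Relation.Unary.All.Properties using () renaming (map⁺ to All-map⁺)
open import Data.Maybe using (Maybe; just; nothing)
open import Data.Maybe.Properties using (just-injective)
open import Data.Nat using (ℕ; zero; suc; _+_; _≤_; _<_; _⊔_; z≤n; s≤s)
open import Data.Nat.Properties
open import Data.Product using (Σ; ∃; _×_; _,_; proj₁; proj₂; swap)
open import Data.Product.Relation.Binary.Lex.Strict using (×-Lex; ×-wellFounded)
open import Data.Sum using (_⊎_; inj₁; inj₂; [_,_]′; map₂)
open import Data.Unit using (⊤; tt)
open import Function using (_↣_; _↔_; mk↣; _∘_; id; case_of_; Injection; Equivalence; Inverse)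
open import Function.Definitions using (Injective)
open import Function.Properties.Injection using (↣-trans)
open import Function.Properties.Inverse using (↔⇒↣)
open import Induction.WellFounded as WF using (Acc; acc; WellFounded; module Subrelation)
import Relation.Binary.Construct.On as On
open import Relation.Binary.PropositionalEquality
open import Relation.Binary.Definitions using (tri<; tri≈; tri>)
open import Relation.Nullary using (¬_; yes; no)
open import Relation.Nullary.Decidable using (decidable-stable; toWitness; fromWitness; ⌊_⌋)

private variable
  I K X Y : Set
  P Q : ℕ → Set

-- Well-orders and finite trees

-- Predecessors form a Bool-valued subset, so that by `Element-≡` a point of a `Segment` is
-- determined by its first component.
record WellOrder (X : Set) : Set where
  infix 4 _≺_
  field
    below : X → 𝒫 X
  _≺_ : X → X → Set
  x ≺ y = x ∈ below y
  field
    ≺-trans : ∀ {x y z} → x ≺ y → y ≺ z → x ≺ z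
    ≺-wellFounded : WellFounded _≺_
    ≺-compare : ∀ x y → x ≺ y ⊎ x ≡ y ⊎ y ≺ x

  Segment : X → Set
  Segment x = Elements (below x)

Element-≡ : {s : 𝒫 X} {x y : Elements s} → proj₁ x ≡ proj₁ y → x ≡ y
Element-≡ {x = x , p} {y = .x , q} refl = cong (x ,_) (T-irrelevant p q)

data Tree (X : Set) : Set where
  nil  : Tree X
  leaf : X → Tree X
  node : Tree X → Tree X → Tree X

leaf-injective : {x y : X} → leaf x ≡ leaf y → x ≡ y
leaf-injective refl = refl

node-injective : {s t s′ t′ : Tree X} → node s t ≡ node s′ t′ → s ≡ s′ × t ≡ t′
node-injective refl = refl , refl

tree-map : X ↣ Y → Tree X ↣ Tree Y
tree-map {X} {Y} f = mk↣ {to = map} (map-injective _ _)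
  where
  map : Tree X → Tree Y
  map nil        = nil
  map (leaf x)   = leaf (Injection.to f x)
  map (node s t) = node (map s) (map t)
  map-injective : ∀ s t → map s ≡ map t → s ≡ t
  map-injective nil        nil          _  = refl
  map-injective (leaf x)   (leaf y)     eq = cong leaf (Injection.injective f (leaf-injective eq))
  map-injective (node s t) (node s′ t′) eq = let eq₁ , eq₂ = node-injective eq in
    cong₂ node (map-injective s s′ eq₁) (map-injective t t′ eq₂)

module _ (em : ∀ {ℓ} → ExcludedMiddle ℓ) (ext : ∀ {ℓ₁ ℓ₂} → Extensionality ℓ₁ ℓ₂) where

  byContradiction : ∀ {ℓ} {A : Set ℓ} → ¬ ¬ A → A
  byContradiction = decidable-stable em

  -- Abstract, so that a predicate can be inferred from its comprehension.
  abstract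
    ⟦_⟧ : (X → Set) → 𝒫 X
    ⟦ P ⟧ x = ⌊ em {P = P x} ⌋

    ∈-intro : {P : X → Set} {x : X} → P x → x ∈ ⟦ P ⟧
    ∈-intro = fromWitness

    ∈-elim : {P : X → Set} {x : X} → x ∈ ⟦ P ⟧ → P x
    ∈-elim = toWitness

  ⊆-antisym : {s t : 𝒫 X} → s ⊆ t → t ⊆ s → s ≡ t
  ⊆-antisym {s = s} {t} s⊆t t⊆s = ext λ x → T-ext (s x) (t x) s⊆t t⊆s
    where
    T-ext : ∀ a b → (T a → T b) → (T b → T a) → a ≡ b
    T-ext true  true  _ _ = refl
    T-ext false false _ _ = refl
    T-ext true  false f _ = ⊥-elim (f tt)
    T-ext false true  _ g = ⊥-elim (g tt)

  -- The well-ordering theorem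

  module Zermelo (X : Set) where

    pick : 𝒫 X → Maybe X
    pick p with em {P = ∃ λ x → ¬ x ∈ p}
    ... | yes (x , _) = just x
    ... | no  _       = nothing

    pick-∉ : ∀ {p x} → pick p ≡ just x → ¬ x ∈ p
    pick-∉ {p} eq with em {P = ∃ λ x → ¬ x ∈ p}
    pick-∉ refl | yes (_ , x∉p) = x∉p

    pick-just : ∀ {p x} → ¬ x ∈ p → ∃ λ y → pick p ≡ just y
    pick-just {p} x∉p with em {P = ∃ λ x → ¬ x ∈ p}
    ... | yes (y , _) = y , refl
    ... | no  ¬∃      = ⊥-elim (¬∃ (_ , x∉p))

    infix 8 _⁺
    _⁺ : 𝒫 X → 𝒫 X
    p ⁺ = ⟦ (λ x → x ∈ p ⊎ pick p ≡ just x) ⟧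

    ⊆⁺ : ∀ {p} → p ⊆ p ⁺
    ⊆⁺ = ∈-intro ∘ inj₁

    ⋃ : 𝒫 (𝒫 X) → 𝒫 X
    ⋃ ps = ⟦ (λ x → ∃ λ p → p ∈ ps × x ∈ p) ⟧

    -- The tower of Zermelo's proof; its least stage is the union of no stages. Unions range over
    -- Bool-valued collections, which keeps `Stage` in `Set`.
    data Stage : 𝒫 X → Set where
      next  : ∀ {p} → Stage p → Stage (p ⁺)
      union : (ps : 𝒫 (𝒫 X)) → (∀ {p} → p ∈ ps → Stage p) → Stage (⋃ ps)

    ⋃⊆or⊇ : ∀ {q : 𝒫 X} (r : 𝒫 X) ps → (∀ {p} → p ∈ ps → p ⊆ q ⊎ r ⊆ p) → ⋃ ps ⊆ q ⊎ r ⊆ ⋃ ps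
    ⋃⊆or⊇ r ps f with em {P = ∃ λ p → p ∈ ps × r ⊆ p}
    ... | yes (p , p∈ps , r⊆p) = inj₂ λ x∈r → ∈-intro (p , p∈ps , r⊆p x∈r)
    ... | no  ¬∃ = inj₁ λ x∈⋃ → let p , p∈ps , x∈p = ∈-elim x∈⋃ in case f p∈ps of λ where
      (inj₁ p⊆q) → p⊆q x∈p
      (inj₂ r⊆p) → ⊥-elim (¬∃ (p , p∈ps , r⊆p))

    -- Nested induction. The outer one is on the first stage; when this is p ⁺ with p ⊆ q, the inner
    -- induction `swapped` on q, with p fixed, leaves either q ⊆ p, so that p = q, or p ⁺ ⊆ q.
    linear : ∀ {p q} → Stage p → Stage q → p ⊆ q ⊎ q ⁺ ⊆ p
    linear {q = q} (union ps stages) t = ⋃⊆or⊇ (q ⁺) ps λ p∈ps → linear (stages p∈ps) t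
    linear {q = q} (next {p} s) t with linear s t
    ... | inj₂ q⁺⊆p = inj₂ λ x∈ → ⊆⁺ (q⁺⊆p x∈)
    ... | inj₁ p⊆q  = conclude (swapped t)
      where
      conclude : q ⊆ p ⊎ p ⁺ ⊆ q → p ⁺ ⊆ q ⊎ q ⁺ ⊆ p ⁺
      conclude (inj₁ q⊆p)  = inj₂ (subst (λ r → q ⁺ ⊆ r ⁺) (⊆-antisym {s = q} {p} q⊆p p⊆q) id)
      conclude (inj₂ p⁺⊆q) = inj₁ p⁺⊆q

      swapped : ∀ {q} → Stage q → q ⊆ p ⊎ p ⁺ ⊆ q
      swapped (union ps stages) = ⋃⊆or⊇ (p ⁺) ps λ p∈ps → swapped (stages p∈ps)
      swapped (next {q} t) with swapped t
      ... | inj₂ p⁺⊆q = inj₂ λ x∈ → ⊆⁺ (p⁺⊆q x∈)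
      ... | inj₁ q⊆p with linear s t
      ...   | inj₁ p⊆q  = inj₂ (subst (λ r → p ⁺ ⊆ r ⁺) (⊆-antisym {s = p} {q} p⊆q q⊆p) id)
      ...   | inj₂ q⁺⊆p = inj₁ q⁺⊆p

    -- The largest stage omitting x. By `pick-before` it determines x, so the inclusion order of the
    -- stages becomes an order of the points.
    before : X → 𝒫 X
    before x = ⋃ ⟦ (λ p → Stage p × ¬ x ∈ p) ⟧

    before-stage : ∀ x → Stage (before x)
    before-stage x = union _ (proj₁ ∘ ∈-elim)

    ∉before : ∀ x → ¬ x ∈ before x
    ∉before x x∈ = let p , p∈ , x∈p = ∈-elim x∈ in proj₂ (∈-elim p∈) x∈p

    ⊆before : ∀ {p x} → Stage p → ¬ x ∈ p → p ⊆ before x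
    ⊆before s x∉p y∈p = ∈-intro (_ , ∈-intro (s , x∉p) , y∈p)

    -- If the next stage still omitted x, it would lie inside `before x` by maximality, although it
    -- contains a point picked outside `before x`.
    pick-before : ∀ x → pick (before x) ≡ just x
    pick-before x with em {P = x ∈ before x ⁺}
    ... | yes x∈ = [ ⊥-elim ∘ ∉before x , id ]′ (∈-elim x∈)
    ... | no  x∉ = let y , eq = pick-just (∉before x) in
      ⊥-elim (pick-∉ eq (⊆before (next (before-stage x)) x∉ (∈-intro (inj₂ eq))))

    before-⊆ : ∀ {p x} → Stage p → x ∈ p → before x ⊆ p
    before-⊆ {p} {x} s x∈p with linear (before-stage x) s
    ... | inj₁ ⊆p  = ⊆p
    ... | inj₂ p⁺⊆ = ⊥-elim (∉before x (p⁺⊆ (⊆⁺ x∈p)))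

    accessible : ∀ {p} → Stage p → ∀ {x} → x ∈ p → Acc (λ x y → x ∈ before y) x
    accessible (union ps stages) x∈ = let p , p∈ps , x∈p = ∈-elim x∈ in accessible (stages p∈ps) x∈p
    accessible (next {p} s) {x} x∈ with ∈-elim x∈
    ... | inj₁ x∈p = accessible s x∈p
    ... | inj₂ eq  = acc λ y∈ → accessible s (case linear (before-stage x) s of λ where
      (inj₁ ⊆p)  → ⊆p y∈
      (inj₂ p⁺⊆) → ⊥-elim (∉before x (p⁺⊆ x∈)))

    wellOrder : WellOrder X
    wellOrder = record
      { below = before
      ; ≺-trans = λ {x} {y} {z} x≺y y≺z → before-⊆ (before-stage z) y≺z x≺y
      ; ≺-wellFounded = λ x → accessible (next (before-stage x)) (∈-intro (inj₂ (pick-before x)))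
      ; ≺-compare = compare
      }
      where
      compare : ∀ x y → x ∈ before y ⊎ x ≡ y ⊎ y ∈ before x
      compare x y with em {P = x ∈ before y} | em {P = y ∈ before x}
      ... | yes x≺y | _       = inj₁ x≺y
      ... | no  _   | yes y≺x = inj₂ (inj₂ y≺x)
      ... | no  x⊀y | no  y⊀x = inj₂ (inj₁ (just-injective (begin
        just x           ≡⟨ pick-before x ⟨
        pick (before x)  ≡⟨ cong pick (⊆-antisym {s = before x} {before y}
                                          (⊆before (before-stage x) y⊀x) (⊆before (before-stage y) x⊀y)) ⟩
        pick (before y)  ≡⟨ pick-before y ⟩
        just y           ∎)))
        where open ≡-Reasoning

  -- Finite and infinite sets of natural numbers as bounded and unbounded predicates

  Bounded Unbounded : (ℕ → Set) → Set
  Bounded P = ∃ λ N → ∀ x → P x → x < N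
  Unbounded P = ∀ N → ∃ λ x → N ≤ x × P x

  ¬bounded⇒unbounded : ¬ Bounded P → Unbounded P
  ¬bounded⇒unbounded ¬b N = byContradiction λ ¬∃ →
    ¬b (N , λ x Px → ≰⇒> λ N≤x → ¬∃ (x , N≤x , Px))

  unbounded⇒¬bounded : Unbounded P → ¬ Bounded P
  unbounded⇒¬bounded u (N , b) = let x , N≤x , Px = u N in <⇒≱ (b x Px) N≤x

  bounded-⊆ : (∀ {x} → P x → Q x) → Bounded Q → Bounded P
  bounded-⊆ P⊆Q (N , b) = N , λ x Px → b x (P⊆Q Px)

  unbounded-⊆ : (∀ {x} → P x → Q x) → Unbounded P → Unbounded Q
  unbounded-⊆ P⊆Q u N = let x , N≤x , Px = u N in x , N≤x , P⊆Q Px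

  bounded-⊎ : Bounded P → Bounded Q → Bounded (λ x → P x ⊎ Q x)
  bounded-⊎ (M , b) (N , c) = M ⊔ N , λ where
    x (inj₁ Px) → <-≤-trans (b x Px) (m≤m⊔n M N)
    x (inj₂ Qx) → <-≤-trans (c x Qx) (m≤n⊔m M N)

  bounded-Any : {R : I → ℕ → Set} (L : List I) → (∀ {i} → i List.∈ L → Bounded (R i)) →
                Bounded (λ x → Any (λ i → R i x) L)
  bounded-Any [] _ = 0 , λ _ ()
  bounded-Any (i ∷ L) f = bounded-⊆ (λ { (here Rx) → inj₁ Rx ; (there any) → inj₂ any })
    (bounded-⊎ (f (here refl)) (bounded-Any L (f ∘ there)))

  bounded-by-cases : (Q : ℕ → Set) → Bounded (λ x → P x × Q x) → Bounded (λ x → P x × ¬ Q x) → Bounded P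
  bounded-by-cases Q b c = bounded-⊆ (λ {x} Px → case em {P = Q x} of λ where
    (yes Qx) → inj₁ (Px , Qx)
    (no ¬Qx) → inj₂ (Px , ¬Qx)) (bounded-⊎ b c)

  sup : (ℕ → ℕ) → ℕ → ℕ
  sup h zero    = 0
  sup h (suc n) = suc (h n) ⊔ sup h n

  <-sup : ∀ h {m n} → m < n → h m < sup h n
  <-sup h {m} {suc n} (s≤s m≤n) with m≤n⇒m<n∨m≡n m≤n
  ... | inj₂ refl = m≤m⊔n (suc (h m)) (sup h m)
  ... | inj₁ m<n  = <-≤-trans (<-sup h m<n) (m≤n⊔m (suc (h n)) (sup h n))

  Finitely : (I → Set) → Set
  Finitely Q = ∃ λ L → ∀ i → Q i → i List.∈ L

  injectiveSequence : {Q : I → Set} → ¬ Finitely Q →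
                      ∃ λ (σ : ℕ → I) → Injective _≡_ _≡_ σ × ∀ n → Q (σ n)
  injectiveSequence {I} {Q} ¬fin = σ , injective , λ n → proj₁ (proj₂ (new (initial n)))
    where
    new : ∀ L → ∃ λ i → Q i × ¬ i List.∈ L
    new L = byContradiction λ ¬∃ → ¬fin (L , λ i Qi → byContradiction λ i∉L → ¬∃ (i , Qi , i∉L))
    initial : ℕ → List I
    initial zero    = []
    initial (suc n) = proj₁ (new (initial n)) ∷ initial n
    σ : ℕ → I
    σ n = proj₁ (new (initial n))
    ∈initial : ∀ {m n} → m < n → σ m List.∈ initial n
    ∈initial {m} {suc n} (s≤s m≤n) with m≤n⇒m<n∨m≡n m≤n
    ... | inj₂ refl = here refl
    ... | inj₁ m<n  = there (∈initial m<n)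
    distinct : ∀ {m n} → m < n → σ m ≢ σ n
    distinct {m} {n} m<n eq =
      proj₂ (proj₂ (new (initial n))) (subst (List._∈ initial n) eq (∈initial m<n))
    injective : Injective _≡_ _≡_ σ
    injective {m} {n} eq with <-cmp m n
    ... | tri< m<n _ _ = ⊥-elim (distinct m<n eq)
    ... | tri≈ _ m≡n _ = m≡n
    ... | tri> _ _ n<m = ⊥-elim (distinct n<m (sym eq))

  eventually-∉ : {σ : ℕ → I} → Injective _≡_ _≡_ σ → ∀ L → ∃ λ N → ∀ n → N ≤ n → ¬ σ n List.∈ L
  eventually-∉ inj [] = 0 , λ _ _ ()
  eventually-∉ {σ = σ} inj (i ∷ L) with eventually-∉ inj L | em {P = ∃ λ n → σ n ≡ i}
  ... | N , ∉L | no ¬∃ = N , λ where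
    n _   (here eq) → ¬∃ (n , eq)
    n N≤n (there ∈L) → ∉L n N≤n ∈L
  ... | N , ∉L | yes (m , eq) = suc m ⊔ N , λ where
    n ≤n (here eq′) → <-irrefl (inj (trans eq (sym eq′))) (≤-trans (m≤m⊔n (suc m) N) ≤n)
    n ≤n (there ∈L) → ∉L n (≤-trans (m≤n⊔m (suc m) N) ≤n) ∈L

  antitone : {b : ℕ → ℕ → Set} → (∀ n {x} → b (suc n) x → b n x) →
             ∀ {m n} → m ≤ n → ∀ {x} → b n x → b m x
  antitone {b} dec {n = n} m≤n bx with m≤n⇒m<n∨m≡n m≤n
  ... | inj₂ refl = bx
  antitone {b} dec {n = suc n} _ bx | inj₁ (s≤s m≤n) = antitone {b} dec m≤n (dec n bx)

  -- Diagonalisation: p m n is taken in b (m + n) and C m, beyond m + n. Only the finitely many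
  -- points with m + n < N can miss b N, while each row p m is an unbounded part of C m.
  pseudoIntersection : (b C : ℕ → ℕ → Set) → (∀ n {x} → b (suc n) x → b n x) →
    (∀ m n → Unbounded (λ x → b n x × C m x)) →
    ∃ λ (e : ℕ → Set) → (∀ {x} → e x → b 0 x) ×
      (∀ n → Bounded (λ x → e x × ¬ b n x)) × (∀ m → Unbounded (λ x → e x × C m x))
  pseudoIntersection b C dec u =
    (λ x → ∃ λ m → ∃ λ n → p m n ≡ x) ,
    (λ { (m , n , refl) → antitone {b} dec z≤n (p∈b m n) }) ,
    (λ N → sup (λ m → sup (p m) N) N , λ { _ ((m , n , refl) , ∉b) →
      let m+n<N = ≰⇒> λ N≤m+n → ∉b (antitone {b} dec N≤m+n (p∈b m n)) in
      <-trans (<-sup (p m) (≤-<-trans (m≤n+m n m) m+n<N))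
              (<-sup (λ m → sup (p m) N) (≤-<-trans (m≤m+n m n) m+n<N)) }) ,
    (λ m N → p m N , ≤-trans (m≤n+m N m) (proj₁ (proj₂ (u m (m + N) (m + N)))) ,
             (m , N , refl) , proj₂ (proj₂ (proj₂ (u m (m + N) (m + N)))))
    where
    p : ℕ → ℕ → ℕ
    p m n = proj₁ (u m (m + n) (m + n))
    p∈b : ∀ m n → b (m + n) (p m n)
    p∈b m n = proj₁ (proj₂ (proj₂ (u m (m + n) (m + n))))

  -- Positive sets

  PairwiseAD : (I → ℕ → Set) → Set
  PairwiseAD A = ∀ {i j} → i ≢ j → Bounded (λ x → A i x × A j x)

  Covered : (I → ℕ → Set) → List I → ℕ → Set
  Covered A L x = Any (λ i → A i x) L

  -- The counterpart of `_∈ℐ⁺_` for indexed families. The empty list is allowed, so a positive set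
  -- is infinite whatever the family is.
  Positive : (I → ℕ → Set) → (ℕ → Set) → Set
  Positive A b = ∀ L → Unbounded (λ x → b x × ¬ Covered A L x)

  module Positivity {I : Set} (A : I → ℕ → Set) where

    ¬positive⇒bounded : ¬ Positive A P → ∃ λ L → Bounded (λ x → P x × ¬ Covered A L x)
    ¬positive⇒bounded ¬pos = byContradiction λ ¬∃ → ¬pos λ L → ¬bounded⇒unbounded λ b → ¬∃ (L , b)

    positive-⊆* : Bounded (λ x → P x × ¬ Q x) → Positive A P → Positive A Q
    positive-⊆* {P} {Q} P⊆*Q pos L = ¬bounded⇒unbounded λ b → unbounded⇒¬bounded (pos L)
      (bounded-by-cases Q (bounded-⊆ (λ ((_ , ∉L) , Qx) → Qx , ∉L) b)
                          (bounded-⊆ (λ ((Px , _) , ¬Qx) → Px , ¬Qx) P⊆*Q))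

    positive-⊆ : (∀ {x} → P x → Q x) → Positive A P → Positive A Q
    positive-⊆ P⊆Q pos L = unbounded-⊆ (λ (Px , ∉L) → P⊆Q Px , ∉L) (pos L)

    positive⇒unbounded : Positive A P → Unbounded P
    positive⇒unbounded pos = unbounded-⊆ proj₁ (pos [])

    bounded-from-cover : ∀ L → Bounded (λ x → P x × ¬ Covered A L x) →
                         (∀ {i} → i List.∈ L → Bounded (λ x → P x × A i x)) → Bounded P
    bounded-from-cover L b f = bounded-by-cases (Covered A L)
      (bounded-⊆ (λ (Px , ∈L) → Any.map (Px ,_) ∈L) (bounded-Any L f)) b

    positive-if-ad : Unbounded P → (∀ i → Bounded (λ x → P x × A i x)) → Positive A P
    positive-if-ad u ad L = ¬bounded⇒unbounded λ b →
      unbounded⇒¬bounded u (bounded-from-cover L b λ {i} _ → ad i)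

    module _ (ad : PairwiseAD A) where

      -- A finite list of members omits some A (σ n) that meets P in an infinite set; the listed
      -- members cover only finitely much of that intersection.
      positive-if-sequence : {σ : ℕ → I} → Injective _≡_ _≡_ σ →
        (∀ N → ∃ λ n → N ≤ n × Unbounded (λ x → P x × A (σ n) x)) → Positive A P
      positive-if-sequence {P = P} {σ = σ} inj meets L = ¬bounded⇒unbounded λ b →
        let N , ∉L = eventually-∉ inj L
            n , N≤n , u = meets N
        in unbounded⇒¬bounded u (bounded-from-cover L
             (bounded-⊆ (λ ((Px , _) , ∉L) → Px , ∉L) b)
             λ {i} i∈L → bounded-⊆ (λ ((_ , Ax) , Aix) → Ax , Aix)
               (ad λ eq → ∉L n N≤n (subst (List._∈ L) (sym eq) i∈L)))

      -- The question is whether infinitely many members meet every b n in an infinite set. If not,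
      -- L lists those that do: by positivity each b n stays infinite outside L, and every other
      -- member has a finite intersection with some b n.
      dichotomy : (b : ℕ → ℕ → Set) → (∀ n {x} → b (suc n) x → b n x) → (∀ n → Positive A (b n)) →
        (∃ λ (σ : ℕ → I) → Injective _≡_ _≡_ σ × ∀ m n → Unbounded (λ x → b n x × A (σ m) x)) ⊎
        (∃ λ L → (∀ n → Unbounded (λ x → b n x × ¬ Covered A L x)) ×
                 ∀ i → ∃ λ n → Bounded (λ x → (b n x × ¬ Covered A L x) × A i x))
      dichotomy b dec pos with em {P = Finitely λ i → ∀ n → Unbounded (λ x → b n x × A i x)}
      ... | no  ¬fin = inj₁ (injectiveSequence ¬fin)
      ... | yes (L , complete) = inj₂ (L , (λ n → pos n L) , λ i → case em {P = i List.∈ L} of λ where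
        (yes i∈L) → 0 , 0 , λ x ((_ , ∉L) , Aix) → ⊥-elim (∉L (List.lose i∈L Aix))
        (no  i∉L) → byContradiction λ ¬∃ → i∉L (complete i λ n → ¬bounded⇒unbounded λ bd →
          ¬∃ (n , bounded-⊆ (λ ((bx , _) , Aix) → bx , Aix) bd)))

      -- In the first case of `dichotomy`, e is made to meet infinitely many members in infinite
      -- sets. In the second, any pseudointersection outside L is infinite and almost disjoint from
      -- all members. Either makes e positive.
      positivePseudoIntersection :
        (b : ℕ → ℕ → Set) → (∀ n {x} → b (suc n) x → b n x) → (∀ n → Positive A (b n)) →
        ∃ λ (e : ℕ → Set) → Positive A e × (∀ {x} → e x → b 0 x) ×
          ∀ n → Bounded (λ x → e x × ¬ b n x)
      positivePseudoIntersection b dec pos with dichotomy b dec pos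
      ... | inj₁ (σ , inj , u) =
        let e , e⊆b , e⊆*b , e∩σ = pseudoIntersection b (λ m → A (σ m)) dec u
        in e , positive-if-sequence inj (λ N → N , ≤-refl , e∩σ N) , e⊆b , e⊆*b
      ... | inj₂ (L , u , small) =
        let b′ = λ n x → b n x × ¬ Covered A L x
            e , e⊆b′ , e⊆*b′ , e-unbounded = pseudoIntersection b′ (λ _ _ → ⊤)
              (λ n (bx , ∉L) → dec n bx , ∉L) (λ _ n → unbounded-⊆ (_, tt) (u n))
        in e ,
           positive-if-ad (unbounded-⊆ proj₁ (e-unbounded 0))
             (λ i → let n , bd = small i in bounded-by-cases (b′ n)
               (bounded-⊆ (λ ((_ , Aix) , b′x) → b′x , Aix) bd)
               (bounded-⊆ (λ ((ex , _) , ∉b′) → ex , ∉b′) (e⊆*b′ n))) ,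
           proj₁ ∘ e⊆b′ ,
           λ n → bounded-⊆ (λ (ex , ∉b) → ex , ∉b ∘ proj₁) (e⊆*b′ n)

  side : Bool → (ℕ → Set) → ℕ → Set
  side true  P x = P x
  side false P x = ¬ P x

  side-⇔ : ∀ i (P Q : ℕ → Set) {x z} → (P x → Q z) → (Q z → P x) → side i P x → side i Q z
  side-⇔ true  _ _ P⇒Q Q⇒P = P⇒Q
  side-⇔ false _ _ P⇒Q Q⇒P = _∘ Q⇒P

  -- (ω,ω)-splitting families

  SplittingPredicates ωωSplittingPredicates : (K → ℕ → Set) → Set₁
  SplittingPredicates y = ∀ s → Unbounded s → ∃ λ k → ∀ i → Unbounded (λ x → s x × side i (y k) x)
  ωωSplittingPredicates y = ∀ (a : ℕ → ℕ → Set) → (∀ n → Unbounded (a n)) →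
    ∃ λ k → ∀ i N → ∃ λ n → N ≤ n × Unbounded (λ x → a n x × side i (y k) x)

  splitting-reindex : (f : X ↣ Y) {y : X → ℕ → Set} → SplittingPredicates y →
                      ∃ λ (z : Y → ℕ → Set) → SplittingPredicates z
  splitting-reindex {Y = Y} f {y} splits = image , λ s u →
    let k , w = splits s u in to k , λ i → unbounded-⊆
      (λ (sx , yx) → sx , side-⇔ i (y k) (image (to k)) (λ ykx → k , refl , ykx)
        (λ { (k′ , eq , yk′x) → subst (λ k → y k _) (injective eq) yk′x }) yx) (w i)
    where
    open Injection f
    image : Y → ℕ → Set
    image t x = ∃ λ k → to k ≡ t × y k x

  module Blocks (f : ℕ → ℕ) where

    start : ℕ → ℕ
    start zero    = 0
    start (suc k) = suc (start k) ⊔ sup f (suc (start k))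

    start-< : ∀ k → start k < start (suc k)
    start-< k = m≤m⊔n _ (sup f (suc (start k)))

    f<start : ∀ {n} k → n ≤ start k → f n < start (suc k)
    f<start k n≤ = <-≤-trans (<-sup f (s≤s n≤)) (m≤n⊔m (suc (start k)) _)

    start-mono : ∀ {k l} → k ≤ l → start k ≤ start l
    start-mono {l = l} k≤l with m≤n⇒m<n∨m≡n k≤l
    ... | inj₂ refl = ≤-refl
    start-mono {l = suc l} _ | inj₁ (s≤s k≤l) = ≤-trans (start-mono k≤l) (<⇒≤ (start-< l))

    ≤start : ∀ k → k ≤ start k
    ≤start zero    = z≤n
    ≤start (suc k) = ≤-<-trans (≤start k) (start-< k)

    Block : ℕ → ℕ → Set
    Block k x = start k ≤ x × x < start (suc k)

    locate : ∀ x → ∃ λ k → Block k x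
    locate zero = 0 , z≤n , start-< 0
    locate (suc x) with locate x
    ... | k , ≤x , x< with m≤n⇒m<n∨m≡n x<
    ...   | inj₁ 1+x< = k , m≤n⇒m≤1+n ≤x , 1+x<
    ...   | inj₂ eq   = suc k , ≤-reflexive (sym eq) , subst (_< start (suc (suc k))) (sym eq) (start-< (suc k))

    block-≤ : ∀ {k l x} → Block k x → x < start (suc l) → k ≤ l
    block-≤ (≤x , _) x< = ≮⇒≥ λ l<k → <⇒≱ x< (≤-trans (start-mono l<k) ≤x)

    block-unique : ∀ {k l x} → Block k x → Block l x → k ≡ l
    block-unique b c = ≤-antisym (block-≤ b (proj₂ c)) (block-≤ c (proj₂ b))

    -- The interval [n, g (g n)) lies in two consecutive blocks, so [n, g n) or
    -- [g n, g (g n)) lies in a single one.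
    long-blocks : ∀ (g : ℕ → ℕ) → (∀ N → ∃ λ n → N ≤ n × g (g n) < f n) →
                  ∀ N → ∃ λ k → N ≤ k × ∃ λ m → start k ≤ m × g m ≤ start (suc k)
    long-blocks g undominated N with undominated (start N)
    ... | n , N≤n , gg< with locate n
    ...   | k , ≤n , n< with ≮⇒≥ (λ k<N → <⇒≱ n< (≤-trans (start-mono k<N) N≤n)) | g n ≤? start (suc k)
    ...     | N≤k | yes g≤ = k , N≤k , n , ≤n , g≤
    ...     | N≤k | no  g≰ = suc k , m≤n⇒m≤1+n N≤k , g n , ≰⇒≥ g≰ ,
                             <⇒≤ (<-trans gg< (f<start (suc k) (<⇒≤ n<)))

  module _ {T : Set} (y : T → ℕ → Set) (splits : SplittingPredicates y)
           (unpair : T → T × T) (unpair-surjective : ∀ t t′ → ∃ λ u → unpair u ≡ (t , t′)) where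

    -- If the sets a n witness that y is not (ω,ω)-splitting, then bounds for
    -- a n ∩ side i (y t), as functions of n, form an undominated family: a
    -- dominating g would give an unsplit set with one element of each a n
    -- beyond g n.
    module Undominated (a : ℕ → ℕ → Set) (a-unbounded : ∀ n → Unbounded (a n))
      (¬split : ¬ ∃ λ t → ∀ i N → ∃ λ n → N ≤ n × Unbounded (λ x → a n x × side i (y t) x)) where

      eventually-bounded : ∀ t → ∃ λ i → ∃ λ N → ∀ n → N ≤ n → Bounded (λ x → a n x × side i (y t) x)
      eventually-bounded t = byContradiction λ ¬∃ → ¬split (t , λ i N → byContradiction λ ¬∃n →
        ¬∃ (i , N , λ n N≤n → byContradiction λ ¬b → ¬∃n (n , N≤n , ¬bounded⇒unbounded ¬b)))

      bound : T → ℕ → ℕ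
      bound t n with em {P = Bounded (λ x → a n x × side (proj₁ (eventually-bounded t)) (y t) x)}
      ... | yes (M , _) = M
      ... | no  _       = 0

      <bound : ∀ t n → proj₁ (proj₂ (eventually-bounded t)) ≤ n → ∀ {x} → a n x →
               side (proj₁ (eventually-bounded t)) (y t) x → x < bound t n
      <bound t n N≤n ax yx with em {P = Bounded (λ x → a n x × side (proj₁ (eventually-bounded t)) (y t) x)}
      ... | yes (_ , b) = b _ (ax , yx)
      ... | no  ¬b      = ⊥-elim (¬b (proj₂ (proj₂ (eventually-bounded t)) n N≤n))

      undominated : ∀ (g : ℕ → ℕ) → ∃ λ t → ∀ N → ∃ λ n → N ≤ n × g n < bound t n
      undominated g = t , λ N → byContradiction λ ¬∃ →
        let N₀ = proj₁ (proj₂ (eventually-bounded t)) in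
        unbounded⇒¬bounded (p-split (proj₁ (eventually-bounded t)))
          (sup p (N ⊔ N₀) , λ { _ ((n , refl) , yp) → <-sup p (≰⇒> λ ≤n →
            <⇒≱ (<bound t n (≤-trans (m≤n⊔m N N₀) ≤n) (p∈a n) yp)
                (≤-trans (≮⇒≥ λ g<b → ¬∃ (n , ≤-trans (m≤m⊔n N N₀) ≤n , g<b))
                         (≤-trans (m≤n⊔m n (g n)) (≤p n)))) })
        where
        p : ℕ → ℕ
        p n = proj₁ (a-unbounded n (n ⊔ g n))
        ≤p : ∀ n → n ⊔ g n ≤ p n
        ≤p n = proj₁ (proj₂ (a-unbounded n (n ⊔ g n)))
        p∈a : ∀ n → a n (p n)
        p∈a n = proj₂ (proj₂ (a-unbounded n (n ⊔ g n)))
        p-splitter : ∃ λ t → ∀ i → Unbounded (λ x → (∃ λ n → p n ≡ x) × side i (y t) x)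
        p-splitter = splits (λ x → ∃ λ n → p n ≡ x) λ N → p N , ≤-trans (m≤m⊔n N (g N)) (≤p N) , N , refl
        t = proj₁ p-splitter
        p-split = proj₂ p-splitter

      open Blocks

      InBlock : ℕ → T × T → Set
      InBlock x (t , t′) = ∃ λ k → y t′ k × Block (bound t) k x

      -- Pairs of a bound and a splitting set are coded by single indices, so the new family is
      -- again indexed by T.
      blockwise : T → ℕ → Set
      blockwise u x = InBlock x (unpair u)

      -- For a suitable bound, infinitely many blocks k meet all c i with i ≤ k. Splitting the set
      -- of these k leaves infinitely many such blocks on each side, so that every single c n is
      -- split.
      blockwise-splits : ωωSplittingPredicates blockwise
      blockwise-splits c c-unbounded = u , λ i N → N , ≤-refl , λ M →
        let k , ≤k , meets , yk = meeting-split i (M ⊔ N)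
            x , cx , block = meets N (≤-trans (m≤n⊔m M N) ≤k)
        in x , ≤-trans (≤-trans (m≤m⊔n M N) ≤k) (≤-trans (≤start (bound t) k) (proj₁ block)) ,
           cx , side-⇔ i (y t′) (blockwise u)
             (λ yk → subst (InBlock x) (sym u-eq) (k , yk , block))
             (λ x∈ → let l , yl , block′ = subst (InBlock x) u-eq x∈ in
               subst (y t′) (block-unique (bound t) block′ block) yl)
             yk
        where
        next : ℕ → ℕ
        next m = sup (λ i → proj₁ (c-unbounded i m)) (suc m)
        <next : ∀ {i m} → i ≤ m → ∃ λ x → c i x × m ≤ x × x < next m
        <next {i} {m} i≤m = let x , m≤x , cx = c-unbounded i m in
          x , cx , m≤x , <-sup (λ i → proj₁ (c-unbounded i m)) (s≤s i≤m)
        -- `next` is iterated because of two consecutive intervals only one is sure to lie in a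
        -- single block; each interval [m, `next` m) meets every c i with i ≤ m.
        t = proj₁ (undominated (next ∘ next))
        Meeting : ℕ → Set
        Meeting k = ∀ i → i ≤ k → ∃ λ x → c i x × Block (bound t) k x
        meeting-unbounded : Unbounded Meeting
        meeting-unbounded N =
          let k , N≤k , m , ≤m , next≤ = long-blocks (bound t) next (proj₂ (undominated (next ∘ next))) N
          in k , N≤k , λ i i≤k →
            let x , cx , m≤x , x< = <next (≤-trans i≤k (≤-trans (≤start (bound t) k) ≤m))
            in x , cx , ≤-trans ≤m m≤x , <-≤-trans x< next≤
        meeting-splitter : ∃ λ t → ∀ i → Unbounded (λ k → Meeting k × side i (y t) k)
        meeting-splitter = splits Meeting meeting-unbounded
        t′ = proj₁ meeting-splitter
        meeting-split = proj₂ meeting-splitter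
        u = proj₁ (unpair-surjective t t′)
        u-eq = proj₂ (unpair-surjective t t′)

    splitting⇒ωωSplitting : ∃ λ (z : T → ℕ → Set) → ωωSplittingPredicates z
    splitting⇒ωωSplitting with em {P = ωωSplittingPredicates y}
    ... | yes ωω = y , ωω
    ... | no ¬ωω =
      byContradiction λ ¬∃ → ¬ωω λ a a-unbounded → byContradiction λ ¬split →
        let open Undominated a a-unbounded ¬split in ¬∃ (blockwise , blockwise-splits)


  -- Well-orders of trees and the index type of the splitting family

  least : (W : WellOrder X) (R : X → Set) → ∃ R → ∃ λ x → R x × ∀ y → WellOrder._≺_ W y x → ¬ R y
  least W R (x , Rx) = go (≺-wellFounded x) Rx
    where
    open WellOrder W
    go : ∀ {x} → Acc _≺_ x → R x → ∃ λ x → R x × ∀ y → y ≺ x → ¬ R y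
    go {x} (acc rs) Rx with em {P = ∃ λ y → y ≺ x × R y}
    ... | yes (y , y≺x , Ry) = go (rs y≺x) Ry
    ... | no  ¬∃ = x , Rx , λ y y≺x Ry → ¬∃ (y , y≺x , Ry)

  segmentOrder : (W : WellOrder X) (x : X) → WellOrder (WellOrder.Segment W x)
  segmentOrder W x = record
    { below = λ (y , _) (z , _) → below y z
    ; ≺-trans = ≺-trans
    ; ≺-wellFounded = On.wellFounded proj₁ ≺-wellFounded
    ; ≺-compare = λ (y , _) (z , _) → case ≺-compare y z of λ where
        (inj₁ y≺z)        → inj₁ y≺z
        (inj₂ (inj₁ y≡z)) → inj₂ (inj₁ (Element-≡ y≡z))
        (inj₂ (inj₂ z≺y)) → inj₂ (inj₂ z≺y)
    }
    where open WellOrder W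

  -- Trees are ordered first by `rank`, an upper bound of the leaves, and then by an arbitrary
  -- well-order. All predecessors of t thus have leaves up to `rank t`, which bounds the size of
  -- their segment.
  module TreeOrder (W : WellOrder X) (x₀ : X) where
    open WellOrder W

    infix 4 _≼_
    _≼_ : X → X → Set
    x ≼ y = x ≺ y ⊎ x ≡ y

    ≼-trans : ∀ {x y z} → x ≼ y → y ≼ z → x ≼ z
    ≼-trans (inj₂ refl) y≼z         = y≼z
    ≼-trans (inj₁ x≺y)  (inj₂ refl) = inj₁ x≺y
    ≼-trans (inj₁ x≺y)  (inj₁ y≺z)  = inj₁ (≺-trans x≺y y≺z)

    max : X → X → X
    max x y with ≺-compare x y
    ... | inj₁ _        = y
    ... | inj₂ (inj₁ _) = y
    ... | inj₂ (inj₂ _) = x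

    ≼-max : ∀ x y → x ≼ max x y × y ≼ max x y
    ≼-max x y with ≺-compare x y
    ... | inj₁ x≺y        = inj₁ x≺y , inj₂ refl
    ... | inj₂ (inj₁ x≡y) = inj₂ x≡y , inj₂ refl
    ... | inj₂ (inj₂ y≺x) = inj₂ refl , inj₁ y≺x

    rank : Tree X → X
    rank nil        = x₀
    rank (leaf x)   = x
    rank (node s t) = max (rank s) (rank t)

    LeavesUpTo : X → Tree X → Set
    LeavesUpTo x nil        = ⊤
    LeavesUpTo x (leaf y)   = y ≼ x
    LeavesUpTo x (node s t) = LeavesUpTo x s × LeavesUpTo x t

    leaves≼rank : ∀ {x} t → rank t ≼ x → LeavesUpTo x t
    leaves≼rank nil        _ = tt
    leaves≼rank (leaf _)   r = r
    leaves≼rank (node s t) r =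
      leaves≼rank s (≼-trans (proj₁ (≼-max _ _)) r) , leaves≼rank t (≼-trans (proj₂ (≼-max _ _)) r)

    -- The leaf x is not in `Segment x` and becomes `node nil nil`. A node is wrapped once more, so
    -- that its left child is a node and the two codes cannot clash.
    encode : ∀ x → Tree X → Tree (Segment x)
    encode x nil        = nil
    encode x (leaf y) with em {P = y ≺ x}
    ... | yes y≺x = leaf (y , y≺x)
    ... | no  _   = node nil nil
    encode x (node s t) = node (node (encode x s) (encode x t)) nil

    encode-injective : ∀ {x} s t → LeavesUpTo x s → LeavesUpTo x t → encode x s ≡ encode x t → s ≡ t
    encode-injective nil nil _ _ _ = refl
    encode-injective {x} nil (leaf y) _ _ eq with em {P = y ≺ x}
    encode-injective nil (leaf _) _ _ () | yes _
    encode-injective nil (leaf _) _ _ () | no _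
    encode-injective {x} (leaf y) nil _ _ eq with em {P = y ≺ x}
    encode-injective (leaf _) nil _ _ () | yes _
    encode-injective (leaf _) nil _ _ () | no _
    encode-injective {x} (leaf y) (leaf z) y≼ z≼ eq with em {P = y ≺ x} | em {P = z ≺ x}
    encode-injective (leaf _) (leaf _) _ _ refl | yes _ | yes _ = refl
    encode-injective (leaf _) (leaf _) _ _ ()   | yes _ | no _
    encode-injective (leaf _) (leaf _) _ _ ()   | no _  | yes _
    ... | no y⊀ | no z⊀ with y≼ | z≼
    ...   | inj₁ y≺   | _         = ⊥-elim (y⊀ y≺)
    ...   | inj₂ _    | inj₁ z≺   = ⊥-elim (z⊀ z≺)
    ...   | inj₂ refl | inj₂ refl = refl
    encode-injective {x} (leaf y) (node _ _) _ _ eq with em {P = y ≺ x}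
    encode-injective (leaf _) (node _ _) _ _ () | yes _
    encode-injective (leaf _) (node _ _) _ _ () | no _
    encode-injective {x} (node _ _) (leaf y) _ _ eq with em {P = y ≺ x}
    encode-injective (node _ _) (leaf _) _ _ () | yes _
    encode-injective (node _ _) (leaf _) _ _ () | no _
    encode-injective (node s t) (node s′ t′) (a , b) (a′ , b′) eq =
      let eq₁ , eq₂ = node-injective (proj₁ (node-injective eq))
      in cong₂ node (encode-injective s s′ a a′ eq₁) (encode-injective t t′ b b′ eq₂)

    private
      V = Zermelo.wellOrder (Tree X)
      module V = WellOrder V

      Lex : Tree X → Tree X → Set
      Lex s t = ×-Lex _≡_ _≺_ V._≺_ (rank s , s) (rank t , t)

    treeOrder : WellOrder (Tree X)
    treeOrder = record
      { below = λ t → ⟦ (λ s → Lex s t) ⟧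
      ; ≺-trans = λ s≺t t≺u → ∈-intro (lex-trans (∈-elim s≺t) (∈-elim t≺u))
      ; ≺-wellFounded = Subrelation.wellFounded ∈-elim
          (On.wellFounded (λ t → rank t , t) (×-wellFounded ≺-wellFounded V.≺-wellFounded))
      ; ≺-compare = compare
      }
      where
      lex-trans : ∀ {s t u} → Lex s t → Lex t u → Lex s u
      lex-trans (inj₁ p)       (inj₁ q)       = inj₁ (≺-trans p q)
      lex-trans (inj₁ p)       (inj₂ (e , _)) = inj₁ (subst (_ ≺_) e p)
      lex-trans (inj₂ (e , _)) (inj₁ q)       = inj₁ (subst (_≺ _) (sym e) q)
      lex-trans (inj₂ (e , p)) (inj₂ (f , q)) = inj₂ (trans e f , V.≺-trans p q)
      compare : ∀ s t → s ∈ ⟦ (λ s → Lex s t) ⟧ ⊎ s ≡ t ⊎ t ∈ ⟦ (λ t → Lex t s) ⟧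
      compare s t with ≺-compare (rank s) (rank t)
      ... | inj₁ r        = inj₁ (∈-intro (inj₁ r))
      ... | inj₂ (inj₂ r) = inj₂ (inj₂ (∈-intro (inj₁ r)))
      ... | inj₂ (inj₁ e) with V.≺-compare s t
      ...   | inj₁ r        = inj₁ (∈-intro (inj₂ (e , r)))
      ...   | inj₂ (inj₁ r) = inj₂ (inj₁ r)
      ...   | inj₂ (inj₂ r) = inj₂ (inj₂ (∈-intro (inj₂ (sym e , r))))

    segment-encoding : ∀ t → (Maybe (WellOrder.Segment treeOrder t) × ℕ) ↣ Tree (Segment (rank t))
    segment-encoding t = mk↣ {to = code} code-injective
      where
      leaves≼ : (s : WellOrder.Segment treeOrder t) → LeavesUpTo (rank t) (proj₁ s)
      leaves≼ (s , s≺t) = leaves≼rank s ([ inj₁ , inj₂ ∘ proj₁ ]′ (∈-elim s≺t))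
      numeral : ℕ → Tree (Segment (rank t))
      numeral zero    = nil
      numeral (suc n) = node nil (numeral n)
      numeral-injective : ∀ m n → numeral m ≡ numeral n → m ≡ n
      numeral-injective zero    zero    _  = refl
      numeral-injective (suc m) (suc n) eq = cong suc (numeral-injective m n (proj₂ (node-injective eq)))
      option : Maybe (WellOrder.Segment treeOrder t) → Tree (Segment (rank t))
      option nothing        = nil
      option (just (s , _)) = node nil (encode (rank t) s)
      option-injective : ∀ m n → option m ≡ option n → m ≡ n
      option-injective nothing  nothing  _  = refl
      option-injective (just s) (just s′) eq = cong just (Element-≡
        (encode-injective (proj₁ s) (proj₁ s′) (leaves≼ s) (leaves≼ s′) (proj₂ (node-injective eq))))
      code : Maybe (WellOrder.Segment treeOrder t) × ℕ → Tree (Segment (rank t))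
      code (m , n) = node (option m) (numeral n)
      code-injective : Injective _≡_ _≡_ code
      code-injective {m , n} {m′ , n′} eq = cong₂ _,_
        (option-injective m m′ (proj₁ (node-injective eq)))
        (numeral-injective n n′ (proj₂ (node-injective eq)))

  -- Tree X contains X, ℕ and its own square, which replaces cardinal
  -- arithmetic: either no Tree (Segment x) over 𝔰 contains 𝔞, or the least x
  -- with 𝔞 ≤ Tree (Segment x) gives the index type, because 𝔰 ≤ 𝔞.
  narrowSplitting : ∀ {𝔰 𝔞} {y : 𝔰 → ℕ → Set} → SplittingPredicates y → 𝔰 ↣ 𝔞 → ¬ (𝔞 ↣ Tree ⊥) →
    ∃ λ (X : Set) → Σ (WellOrder X) λ W → X × (∀ x → ¬ (𝔞 ↣ Tree (WellOrder.Segment W x))) ×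
    ∃ λ (z : Tree X → ℕ → Set) → SplittingPredicates z
  narrowSplitting {𝔰} {𝔞} {y} splits 𝔰↣𝔞 uncountable =
    case em {P = ∃ λ x → 𝔞 ↣ Tree (Segment x)} of λ where
      (no ¬∃) → 𝔰 , W , proj₁ (splits (λ _ → ⊤) λ N → N , ≤-refl , tt) , (λ x f → ¬∃ (x , f)) ,
                splitting-reindex (mk↣ leaf-injective) splits
      (yes ∃x) → let x , 𝔞↣ , minimal = least W (λ x → 𝔞 ↣ Tree (Segment x)) ∃x in
        Segment x , segmentOrder W x ,
        -- If `Segment x` were empty, 𝔞 would embed in the countable type `Tree ⊥`.
        byContradiction (λ empty → uncountable (↣-trans 𝔞↣
          (tree-map (mk↣ {to = λ y → empty y} λ {y} → ⊥-elim (empty y))))) ,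
        (λ (z , z≺x) f → minimal z z≺x (↣-trans f (tree-map
          (mk↣ {to = λ ((y , _) , y≺z) → y , y≺z} λ eq → Element-≡ (Element-≡ (cong proj₁ eq)))))) ,
        splitting-reindex (↣-trans 𝔰↣𝔞 𝔞↣) splits
    where
    W = Zermelo.wellOrder 𝔰
    open WellOrder W

  -- The pairs index the conditions `critical` that a new member with a node of height k must
  -- satisfy; `avoid` meets them when 𝔞 does not embed in their index type.
  NarrowOrder : Set → WellOrder K → Set
  NarrowOrder 𝔞 W = ∀ k → ¬ (𝔞 ↣ (Maybe (WellOrder.Segment W k) × ℕ))

  narrowωωSplitting : ∀ {𝔰 𝔞} {y : 𝔰 → ℕ → Set} → SplittingPredicates y → 𝔰 ↣ 𝔞 → ¬ (𝔞 ↣ Tree ⊥) →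
    ∃ λ (K : Set) → Σ (WellOrder K) λ W → NarrowOrder 𝔞 W ×
    ∃ λ (z : K → ℕ → Set) → ωωSplittingPredicates z
  narrowωωSplitting splits 𝔰↣𝔞 uncountable =
    let X , W , x₀ , narrow , z , z-splits = narrowSplitting splits 𝔰↣𝔞 uncountable
        open TreeOrder W x₀
    in Tree X , treeOrder , (λ t f → narrow (rank t) (↣-trans f (segment-encoding t))) ,
       splitting⇒ωωSplitting z z-splits unpair (λ s t → node s t , refl)
    where
    unpair : Tree X → Tree X × Tree X
    unpair nil        = nil , nil
    unpair (leaf _)   = nil , nil
    unpair (node s t) = s , t


  -- Maximality and 𝔞

  ∈-∩⁺ : (s t : 𝒫 X) {x : X} → x ∈ s → x ∈ t → x ∈ s ∩ t
  ∈-∩⁺ s t {x} x∈s x∈t = Equivalence.from (T-∧ {s x} {t x}) (x∈s , x∈t)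

  ∈-∖⁻ : (s t : 𝒫 X) {x : X} → x ∈ s ∖ t → x ∈ s × ¬ x ∈ t
  ∈-∖⁻ s t {x} x∈ with s x | t x
  ... | true | false = tt , id

  ∈-∩⁻ : (s t : 𝒫 X) {x : X} → x ∈ s ∩ t → x ∈ s × x ∈ t
  ∈-∩⁻ s t {x} = Equivalence.to (T-∧ {s x} {t x})

  bounded⇒finite : {s : 𝒫 ℕ} → Bounded (_∈ s) → Finite s
  bounded⇒finite (N , b) = upTo N , λ {x} x∈s → ∈-upTo⁺ (b x x∈s)

  finite⇒bounded : {s : 𝒫 ℕ} → Finite s → Bounded (_∈ s)
  finite⇒bounded (xs , f) = bounded-⊆ f (bounded-Any xs λ {i} _ → suc i , λ { x refl → ≤-refl })

  infinite⇒unbounded : {s : 𝒫 ℕ} → Infinite s → Unbounded (_∈ s)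
  infinite⇒unbounded inf = ¬bounded⇒unbounded (inf ∘ bounded⇒finite)

  unbounded⇒infinite : {s : 𝒫 ℕ} → Unbounded (_∈ s) → Infinite s
  unbounded⇒infinite u = unbounded⇒¬bounded u ∘ finite⇒bounded

  finite-∩⁺ : (s t : 𝒫 ℕ) → Bounded (λ x → x ∈ s × x ∈ t) → Finite (s ∩ t)
  finite-∩⁺ s t b = bounded⇒finite (bounded-⊆ (∈-∩⁻ s t) b)

  finite-∩⁻ : (s t : 𝒫 ℕ) → Finite (s ∩ t) → Bounded (λ x → x ∈ s × x ∈ t)
  finite-∩⁻ s t f = bounded-⊆ (λ (x∈s , x∈t) → ∈-∩⁺ s t x∈s x∈t) (finite⇒bounded f)

  -- Otherwise P could be adjoined to ℱ. It would be a new member, since its intersection with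
  -- itself is infinite.
  mad-meets : ∀ {ℱ} → MaximalAlmostDisjoint ℱ → Unbounded P →
              ¬ (∀ {s} → s ∈ ℱ → Bounded (λ x → P x × x ∈ s))
  mad-meets {P} {ℱ} (_ , (inf , ad) , maximal) u small = maximal
    (ℬ , (ℬ-infinite , ℬ-ad) , ∈-intro ∘ inj₁ ,
     λ ℬ⊆ℱ → unbounded⇒¬bounded u (bounded-⊆ (λ Px → Px , ∈-intro Px) (small (ℬ⊆ℱ (∈-intro (inj₂ refl))))))
    where
    new = ⟦ P ⟧
    ℬ = ⟦ (λ s → s ∈ ℱ ⊎ s ≡ new) ⟧
    ℬ-infinite : ∀ {s} → s ∈ ℬ → Infinite s
    ℬ-infinite s∈ with ∈-elim s∈
    ... | inj₁ s∈ℱ  = inf s∈ℱ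
    ... | inj₂ refl = unbounded⇒infinite (unbounded-⊆ ∈-intro u)
    ℬ-ad : ∀ {s t} → s ∈ ℬ → t ∈ ℬ → s ≢ t → Finite (s ∩ t)
    ℬ-ad {s} {t} s∈ t∈ s≢t with ∈-elim s∈ | ∈-elim t∈
    ... | inj₁ s∈ℱ  | inj₁ t∈ℱ  = ad s∈ℱ t∈ℱ s≢t
    ... | inj₁ s∈ℱ  | inj₂ refl = finite-∩⁺ s t (bounded-⊆ (λ (x∈s , x∈t) → ∈-elim x∈t , x∈s) (small s∈ℱ))
    ... | inj₂ refl | inj₁ t∈ℱ  = finite-∩⁺ s t (bounded-⊆ (λ (x∈s , x∈t) → ∈-elim x∈s , x∈t) (small t∈ℱ))
    ... | inj₂ refl | inj₂ refl = ⊥-elim (s≢t refl)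

  Countable : Set → Set
  Countable X = ∃ λ (C : ℕ → List X) → ∀ x → ∃ λ n → x List.∈ C n

  countable-↣ : X ↣ Y → Countable Y → Countable X
  countable-↣ {X} {Y} f (C , covers) = preimages ∘ C ,
    λ x → let n , fx∈ = covers (to x) in n , ∈preimages (C n) x fx∈
    where
    open Injection f
    preimages : List Y → List X
    preimages [] = []
    preimages (y ∷ L) with em {P = ∃ λ x → to x ≡ y}
    ... | yes (x , _) = x ∷ preimages L
    ... | no  _       = preimages L
    ∈preimages : ∀ L x → to x List.∈ L → x List.∈ preimages L
    ∈preimages (y ∷ L) x fx∈ with em {P = ∃ λ x → to x ≡ y} | fx∈
    ... | yes (x′ , eq) | here eq′  = here (injective (trans eq′ (sym eq)))
    ... | yes _         | there fx∈ = there (∈preimages L x fx∈)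
    ... | no  ¬∃        | here eq   = ⊥-elim (¬∃ (x , eq))
    ... | no  _         | there fx∈ = ∈preimages L x fx∈

  tree-countable : Countable (Tree ⊥)
  tree-countable = trees , covers
    where
    trees : ℕ → List (Tree ⊥)
    trees zero    = []
    trees (suc n) = nil ∷ trees n ++ cartesianProductWith node (trees n) (trees n)
    trees-mono : ∀ {m n t} → m ≤ n → t List.∈ trees m → t List.∈ trees n
    trees-mono m≤n t∈ with m≤n⇒m<n∨m≡n m≤n
    ... | inj₂ refl = t∈
    trees-mono {n = suc n} _ t∈ | inj₁ (s≤s m≤n) = there (∈-++⁺ˡ (trees-mono m≤n t∈))
    covers : ∀ t → ∃ λ n → t List.∈ trees n
    covers nil = 1 , here refl
    covers (node s t) = let m , s∈ = covers s
                            n , t∈ = covers t in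
      suc (m ⊔ n) , there (∈-++⁺ʳ (trees (m ⊔ n)) (∈-cartesianProductWith⁺ node
        (trees-mono (m≤m⊔n m n) s∈) (trees-mono (m≤n⊔m m n) t∈)))

  -- No finite union of members of an infinite almost disjoint family is cofinite. The complements
  -- of the finite unions along the enumeration therefore have an infinite pseudointersection.
  countable-ad-extends : (A : I → ℕ → Set) → PairwiseAD A → (∀ i → Unbounded (A i)) →
    ¬ Finitely {I} (λ _ → ⊤) → Countable I →
    ∃ λ (e : ℕ → Set) → Unbounded e × ∀ i → Bounded (λ x → e x × A i x)
  countable-ad-extends {I} A ad A-unbounded infinite (C , covers) =
    let σ , injective , _ = injectiveSequence infinite
        pos = Positivity.positive-if-sequence A ad {P = λ _ → ⊤} injective
                λ N → N , ≤-refl , unbounded-⊆ (tt ,_) (A-unbounded (σ N))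
        e , _ , e⊆*b , e-unbounded = pseudoIntersection b (λ _ _ → ⊤) (λ n ¬cov cov → ¬cov (++⁺ʳ (C n) cov))
          λ _ n → unbounded-⊆ (λ (_ , ∉L) → ∉L , tt) (pos (initial n))
    in e , unbounded-⊆ proj₁ (e-unbounded 0) , λ i →
      let n , i∈ = covers i in
      bounded-⊆ (λ (ex , Aix) → ex , λ ¬cov → ¬cov (List.lose (∈-++⁺ˡ i∈) Aix)) (e⊆*b (suc n))
    where
    initial : ℕ → List I
    initial zero    = []
    initial (suc n) = C n ++ initial n
    b : ℕ → ℕ → Set
    b n x = ¬ Covered A (initial n) x

  elements-ad : ∀ {ℱ} → AlmostDisjoint ℱ → PairwiseAD {Elements ℱ} (λ (s , _) x → x ∈ s)
  elements-ad (_ , ad) {s , s∈} {t , t∈} s≢t = finite-∩⁻ s t (ad s∈ t∈ (s≢t ∘ Element-≡))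

  infinite⇒¬finitely : {s : 𝒫 X} → Infinite s → ¬ Finitely {Elements s} (λ _ → ⊤)
  infinite⇒¬finitely inf (L , complete) = inf (List.map proj₁ L , λ x∈s → ∈-map⁺ proj₁ (complete (_ , x∈s) tt))

  mad-uncountable : ∀ {ℱ} → MaximalAlmostDisjoint ℱ → ¬ Countable (Elements ℱ)
  mad-uncountable mad@(inf , ad , _) countable =
    let e , u , small = countable-ad-extends (λ (s , _) x → x ∈ s) (elements-ad ad)
          (λ (_ , s∈) → infinite⇒unbounded (proj₁ ad s∈)) (infinite⇒¬finitely inf) countable
    in mad-meets mad u λ s∈ → small (_ , s∈)

  -- On e the traces of A ∘ g form an a.d. family too small to be maximal.  To
  -- view it as a family on ω, the complement of e is added to one trace.
  module _ {𝔞 : Set} (is𝔞 : Is𝔞 𝔞) (A : I → ℕ → Set) (ad : PairwiseAD A) where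

    avoid : (g : X → I) → ¬ (𝔞 ↣ X) → (e : ℕ → Set) → Positive A e →
            ∃ λ (a : ℕ → Set) → Unbounded a × (∀ {x} → a x → e x) ×
            ∀ x → Bounded (λ n → a n × A (g x) n)
    avoid {X} g 𝔞≰X e pos with em {P = Finitely λ i → (∃ λ x → g x ≡ i) × Unbounded (λ n → e n × A i n)}
    -- Removing the finitely many relevant members with infinite trace from e is enough; positivity
    -- keeps the rest infinite.
    ... | yes (L , complete) = (λ n → e n × ¬ Covered A L n) , pos L , proj₁ , λ x →
      byContradiction λ ¬b → ¬b (0 , λ n ((_ , ∉L) , Agn) → ⊥-elim (∉L (List.lose
        (complete (g x) ((x , refl) , ¬bounded⇒unbounded λ b →
          ¬b (bounded-⊆ (λ ((en , _) , Agn) → en , Agn) b))) Agn)))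
    ... | no ¬fin = (λ n → n ∈ t × e n) , t∩e-unbounded , proj₂ , t∩e-ad
      where
      Met : I → Set
      Met i = (∃ λ x → g x ≡ i) × Unbounded (λ n → e n × A i n)
      sequence = injectiveSequence ¬fin
      σ = proj₁ sequence
      σ-met : ∀ n → Met (σ n)
      σ-met = proj₂ (proj₂ sequence)
      i₀ = σ 0
      trace : I → 𝒫 ℕ
      trace i = ⟦ (λ n → e n × A i n ⊎ i ≡ i₀ × ¬ e n) ⟧
      trace-unbounded : ∀ {i} → Met i → Unbounded (_∈ trace i)
      trace-unbounded (_ , u) = unbounded-⊆ (∈-intro ∘ inj₁) u
      trace-ad : ∀ {i j} → i ≢ j → Bounded (λ n → n ∈ trace i × n ∈ trace j)
      trace-ad {i} {j} i≢j = bounded-⊆ (λ (ni , nj) → both (∈-elim ni) (∈-elim nj)) (ad i≢j)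
        where
        both : ∀ {n} → e n × A i n ⊎ i ≡ i₀ × ¬ e n → e n × A j n ⊎ j ≡ i₀ × ¬ e n → A i n × A j n
        both (inj₁ (_ , p))  (inj₁ (_ , q))  = p , q
        both (inj₁ (en , _)) (inj₂ (_ , ¬en)) = ⊥-elim (¬en en)
        both (inj₂ (_ , ¬en)) (inj₁ (en , _)) = ⊥-elim (¬en en)
        both (inj₂ (p , _))  (inj₂ (q , _))  = ⊥-elim (i≢j (trans p (sym q)))
      trace-injective : ∀ {i j} → Met i → trace i ≡ trace j → i ≡ j
      trace-injective {i} {j} met eq = byContradiction λ i≢j → unbounded⇒¬bounded (trace-unbounded met)
        (bounded-⊆ (λ {n} n∈ → n∈ , subst (n ∈_) eq n∈) (trace-ad i≢j))
      ℳ : Family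
      ℳ = ⟦ (λ s → ∃ λ x → Met (g x) × s ≡ trace (g x)) ⟧
      trace∈ℳ : ∀ {i} → Met i → trace i ∈ ℳ
      trace∈ℳ met@((x , refl) , _) = ∈-intro (x , met , refl)
      ℳ-ad : AlmostDisjoint ℳ
      ℳ-ad = (λ s∈ → let x , met , eq = ∈-elim s∈ in
                subst Infinite (sym eq) (unbounded⇒infinite (trace-unbounded met))) ,
             λ {s} {t} s∈ t∈ s≢t → let x , _ , eq = ∈-elim s∈
                                       y , _ , eq′ = ∈-elim t∈ in
               subst₂ (λ s t → Finite (s ∩ t)) (sym eq) (sym eq′)
                 (finite-∩⁺ (trace (g x)) (trace (g y)) (trace-ad λ gx≡gy →
                   s≢t (trans eq (trans (cong trace gx≡gy) (sym eq′)))))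
      ℳ-infinite : Infinite ℳ
      ℳ-infinite (L , complete) =
        let N , ∉L = eventually-∉ {σ = trace ∘ σ}
              (λ {m} eq → proj₁ (proj₂ sequence) (trace-injective (σ-met m) eq)) L
        in ∉L N ≤-refl (complete (trace∈ℳ (σ-met N)))
      ℳ↣X : Elements ℳ ↣ X
      ℳ↣X = mk↣ {to = λ (s , s∈) → proj₁ (∈-elim s∈)} λ {(s , s∈)} {(t , t∈)} eq →
        Element-≡ (trans (proj₂ (proj₂ (∈-elim s∈)))
          (trans (cong (trace ∘ g) eq) (sym (proj₂ (proj₂ (∈-elim t∈))))))
      extension : ∃ λ ℬ → AlmostDisjoint ℬ × ℳ ⊂ ℬ
      extension = byContradiction λ maximal →
        𝔞≰X (↣-trans (proj₂ is𝔞 ℳ (ℳ-infinite , ℳ-ad , maximal)) ℳ↣X)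
      ℬ = proj₁ extension
      ℬ-ad = proj₁ (proj₂ extension)
      ℳ⊆ℬ : ℳ ⊆ ℬ
      ℳ⊆ℬ = proj₁ (proj₂ (proj₂ extension))
      member : ∃ λ t → t ∈ ℬ × ¬ t ∈ ℳ
      member = byContradiction λ ¬∃ → proj₂ (proj₂ (proj₂ extension)) λ {t} t∈ →
        byContradiction λ t∉ → ¬∃ (t , t∈ , t∉)
      t = proj₁ member
      t-ad : ∀ {i} → Met i → Bounded (λ n → n ∈ t × n ∈ trace i)
      t-ad {i} met = finite-∩⁻ t (trace i) (proj₂ ℬ-ad (proj₁ (proj₂ member)) (ℳ⊆ℬ (trace∈ℳ met))
        λ eq → proj₂ (proj₂ member) (subst (_∈ ℳ) (sym eq) (trace∈ℳ met)))
      -- The trace of i₀ contains the complement of e, so t, being almost disjoint from it, is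
      -- almost contained in e.
      t∩e-unbounded : Unbounded (λ n → n ∈ t × e n)
      t∩e-unbounded = ¬bounded⇒unbounded λ b →
        unbounded⇒¬bounded (infinite⇒unbounded (proj₁ ℬ-ad (proj₁ (proj₂ member))))
          (bounded-by-cases e b (bounded-⊆ (λ (n∈t , ¬en) → n∈t , ∈-intro (inj₂ (refl , ¬en))) (t-ad (σ-met 0))))
      t∩e-ad : ∀ x → Bounded (λ n → (n ∈ t × e n) × A (g x) n)
      t∩e-ad x = case em {P = Bounded (λ n → e n × A (g x) n)} of λ where
        (yes b) → bounded-⊆ (λ ((_ , en) , An) → en , An) b
        (no ¬b) → bounded-⊆ (λ ((n∈t , en) , An) → n∈t , ∈-intro (inj₁ (en , An)))
                    (t-ad ((x , refl) , ¬bounded⇒unbounded ¬b))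

  side-cover : ∀ i {x} → side (not i) P x ⊎ side i P x
  side-cover {P} i {x} with em {P = P x}
  side-cover true  | yes Px = inj₂ Px
  side-cover true  | no ¬Px = inj₁ ¬Px
  side-cover false | yes Px = inj₁ Px
  side-cover false | no ¬Px = inj₂ ¬Px

  side-disjoint : ∀ i {x} → side i P x → ¬ side (not i) P x
  side-disjoint true  Px  ¬Px = ¬Px Px
  side-disjoint false ¬Px Px  = ¬Px Px

  -- The tree of divisions of a positive set

  module Splitters (A : I → ℕ → Set) (ad : PairwiseAD A)
                   (y : K → ℕ → Set) (ωω : ωωSplittingPredicates y) where
    open Positivity A

    Divides : K → (ℕ → Set) → Set
    Divides k b = ∀ i → Positive A (λ x → b x × side i (y k) x)

    -- If b has infinite traces on infinitely many members, these traces are split, and each side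
    -- keeps infinitely many infinite traces. Otherwise the constant sequence b minus finitely many
    -- members is split; its parts are infinite and almost disjoint from every member.
    positive-divided : {b : ℕ → Set} → Positive A b → ∃ λ k → Divides k b
    positive-divided {b} pos with dichotomy ad (λ _ → b) (λ _ → id) (λ _ → pos)
    ... | inj₁ (σ , injective , u) =
      let k , split = ωω (λ n x → b x × A (σ n) x) (λ n → u n 0) in
      k , λ i → positive-if-sequence ad injective λ N →
        let n , N≤n , u = split i N in
        n , N≤n , unbounded-⊆ (λ ((bx , Ax) , yx) → (bx , yx) , Ax) u
    ... | inj₂ (L , u , small) =
      let k , split = ωω (λ _ x → b x × ¬ Covered A L x) u in
      k , λ i → positive-⊆ (λ ((bx , _) , yx) → bx , yx)
        (positive-if-ad (proj₂ (proj₂ (split i 0))) λ j →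
          bounded-⊆ (λ ((b′x , _) , Ax) → b′x , Ax) (proj₂ (small j)))

  -- σ ⊑ τ means that τ extends σ, where (k , h) stands for the sequence h
  -- restricted to the predecessors of k.
  module Nodes (W : WellOrder K) where
    open WellOrder W

    Node : Set
    Node = K × (K → Bool)

    infix 4 _⊑_
    _⊑_ : Node → Node → Set
    (k , h) ⊑ (k′ , h′) = ∀ j → j ≺ k → j ≺ k′ × h j ≡ h′ j

  module Branches (A : I → ℕ → Set) (ad : PairwiseAD A) (W : WellOrder K)
                  (y : K → ℕ → Set) (ωω : ωωSplittingPredicates y)
                  (b₀ : ℕ → Set) (b₀-positive : Positive A b₀) where
    open WellOrder W
    open Nodes W
    open Positivity A
    open Splitters A ad y ωω

    abstract
      firstDivider : (b : Σ (ℕ → Set) (Positive A)) →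
                     ∃ λ k → Divides k (proj₁ b) × ∀ j → j ≺ k → ¬ Divides j (proj₁ b)
      firstDivider (b , pos) = least W (λ k → Divides k b) (positive-divided pos)

    level : Σ (ℕ → Set) (Positive A) → K
    level b = proj₁ (firstDivider b)

    child : Σ (ℕ → Set) (Positive A) → Bool → Σ (ℕ → Set) (Positive A)
    child b i = (λ x → proj₁ b x × side i (y (level b)) x) , proj₁ (proj₂ (firstDivider b)) i

    -- Whatever divides the child divides b, so the level cannot drop; it cannot stay, since the
    -- child lies on one side of y (`level b`).
    level-child : ∀ b i → level b ≺ level (child b i)
    level-child b i = case ≺-compare (level b) (level (child b i)) of λ where
      (inj₁ p) → p
      (inj₂ (inj₁ eq)) → ⊥-elim (unbounded⇒¬bounded
        (positive⇒unbounded (subst (λ k → Divides k (proj₁ (child b i))) (sym eq)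
          (proj₁ (proj₂ (firstDivider (child b i)))) (not i)))
        (0 , λ x ((_ , yx) , y′x) → ⊥-elim (side-disjoint i yx y′x)))
      (inj₂ (inj₂ p)) → ⊥-elim (proj₂ (proj₂ (firstDivider b)) _ p λ i′ →
        positive-⊆ (λ ((bx , _) , yx) → bx , yx) (proj₁ (proj₂ (firstDivider (child b i))) i′))

    path : (ℕ → Bool) → ℕ → Σ (ℕ → Set) (Positive A)
    path f zero    = b₀ , b₀-positive
    path f (suc n) = child (path f n) (f n)

    on : (ℕ → Bool) → ℕ → ℕ → Set
    on f n = proj₁ (path f n)

    on-decreasing : ∀ f n {x} → on f (suc n) x → on f n x
    on-decreasing f n = proj₁

    Avoids : (ℕ → Bool) → Bool → K → Set
    Avoids f i k = ∃ λ n → ¬ Positive A (λ x → on f n x × side i (y k) x)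

    -- The value i at k of the node of f is chosen so that some set on the path
    -- of f meets the side not i of y k in a set of the ideal.
    value : (ℕ → Bool) → K → Bool
    value f k = ⌊ em {P = Avoids f false k} ⌋

    value-avoids : ∀ f {k} n → k ≺ level (path f n) → Avoids f (not (value f k)) k
    value-avoids f {k} n k≺ with em {P = Avoids f false k}
    ... | yes avoids = avoids
    ... | no ¬avoids = n , λ pos → proj₂ (proj₂ (firstDivider (path f n))) k k≺ λ where
      true  → pos
      false → byContradiction λ ¬pos → ¬avoids (n , ¬pos)

    -- From step n + 1 on, all sets of the path lie on side f n and are positive, so that side is
    -- never avoided, while the other one is avoided at step n + 1.
    value-level : ∀ f n → value f (level (path f n)) ≡ f n
    value-level f n with em {P = Avoids f false (level (path f n))} | f n in fn
    ... | yes _       | true  = refl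
    ... | no  _       | false = refl
    ... | no ¬avoids  | true  = ⊥-elim (¬avoids (suc n , λ pos →
      unbounded⇒¬bounded (positive⇒unbounded pos)
        (0 , λ x ((_ , yx) , ¬yx) → ⊥-elim (¬yx (subst (λ i → side i (y (level (path f n))) x) fn yx)))))
    ... | yes (m , ¬pos) | false = ⊥-elim (¬pos (positive-⊆
      (λ {x} on-x → antitone {on f} (on-decreasing f) (m≤m⊔n m (suc n)) on-x ,
        subst (λ i → side i (y (level (path f n))) x) fn 
          (proj₂ (antitone {on f} (on-decreasing f) (m≤n⊔m m (suc n)) on-x)))
      (proj₂ (path f (m ⊔ suc n)))))

    abstract
      limit : ∀ f → ∃ λ (e : ℕ → Set) → Positive A e × (∀ {x} → e x → b₀ x) ×
                    ∀ n → Bounded (λ x → e x × ¬ on f n x)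
      limit f = positivePseudoIntersection ad (on f) (on-decreasing f) (λ n → proj₂ (path f n))

    limitSet : (ℕ → Bool) → ℕ → Set
    limitSet f = proj₁ (limit f)

    limit-avoids : ∀ f {k} n → k ≺ level (path f n) →
                   ¬ Positive A (λ x → limitSet f x × side (not (value f k)) (y k) x)
    limit-avoids f n k≺ pos =
      let m , ¬pos = value-avoids f n k≺
          _ , _ , _ , e⊆* = limit f
      in ¬pos (positive-⊆* (bounded-⊆ (λ ((ex , yx) , ¬both) → ex , λ on-x → ¬both (on-x , yx)) (e⊆* m)) pos)

    abstract
      -- The supremum of the levels. If every k were below some level, then by `limit-avoids`
      -- nothing would divide the positive set `limitSet f`.
      height : ∀ f → ∃ λ k → (∀ n → ¬ k ≺ level (path f n)) ×
                             ∀ j → j ≺ k → ¬ (∀ n → ¬ j ≺ level (path f n))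
      height f = least W _ (byContradiction λ ¬∃ →
        let k , divides = positive-divided (proj₁ (proj₂ (limit f)))
            n , k≺ = byContradiction λ ¬n → ¬∃ (k , λ n k≺ → ¬n (n , k≺))
        in limit-avoids f n k≺ (divides (not (value f k))))

    node-of : (ℕ → Bool) → Node
    node-of f = proj₁ (height f) , value f

    below-height : ∀ f {j} → j ≺ proj₁ (height f) → ∃ λ n → j ≺ level (path f n)
    below-height f {j} j≺ = byContradiction λ ¬∃ →
      proj₂ (proj₂ (height f)) j j≺ λ n j≺ → ¬∃ (n , j≺)

    level≺height : ∀ f n → level (path f n) ≺ proj₁ (height f)
    level≺height f n = case ≺-compare (level (path f n)) (proj₁ (height f)) of λ where
      (inj₁ p)         → p
      (inj₂ (inj₁ eq)) → ⊥-elim (proj₁ (proj₂ (height f)) (suc n)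
        (subst (_≺ level (path f (suc n))) eq (level-child (path f n) (f n))))
      (inj₂ (inj₂ p))  → ⊥-elim (proj₁ (proj₂ (height f)) n p)

    -- The n-th set of a path depends only on the first n choices, and τ at its level gives the next
    -- choice. The two paths thus coincide by induction.
    common-extension⇒≡ : ∀ f g {τ} → node-of f ⊑ τ → node-of g ⊑ τ → ∀ n → f n ≡ g n
    common-extension⇒≡ f g {_ , h} f⊑ g⊑ n = trans (sym (f≡h n)) (trans (cong (h ∘ level) (path-≡ n)) (g≡h n))
      where
      f≡h : ∀ n → h (level (path f n)) ≡ f n
      f≡h n = trans (sym (proj₂ (f⊑ _ (level≺height f n)))) (value-level f n)
      g≡h : ∀ n → h (level (path g n)) ≡ g n
      g≡h n = trans (sym (proj₂ (g⊑ _ (level≺height g n)))) (value-level g n)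
      path-≡ : ∀ n → path f n ≡ path g n
      path-≡ zero = refl
      path-≡ (suc n) = cong₂ child (path-≡ n)
        (trans (sym (f≡h n)) (trans (cong (h ∘ level) (path-≡ n)) (g≡h n)))


  -- Adding one member to the family

  module Extension {𝔞 : Set} (is𝔞 : Is𝔞 𝔞) (W : WellOrder K) (narrow : NarrowOrder 𝔞 W)
    (y : K → ℕ → Set) (ωω : ωωSplittingPredicates y) where
    open WellOrder W
    open Nodes W

    Follows : (ℕ → Set) → Node → Set
    Follows a (k , h) = ∀ j → j ≺ k → Bounded (λ x → a x × side (not (h j)) (y j) x)

    disagree⇒ad : ∀ {a b} σ τ → Follows a σ → Follows b τ → ∀ j → j ≺ proj₁ σ → j ≺ proj₁ τ →
                  proj₂ σ j ≢ proj₂ τ j → Bounded (λ x → a x × b x)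
    disagree⇒ad (_ , h) (_ , h′) a-follows b-follows j j≺ j≺′ h≢h′ =
      bounded-⊆ (λ (ax , bx) → case side-cover {y j} (h j) of λ where
          (inj₁ yx) → inj₁ (ax , yx)
          (inj₂ yx) → inj₂ (bx , subst (λ i → side i (y j) _) (¬-not h≢h′) yx))
        (bounded-⊎ (a-follows j j≺) (b-follows j j≺′))

    module _ {E : Set} (A : ℕ ⊎ E → ℕ → Set) (ad : PairwiseAD A) (node-at : E → Node)
      (follows : ∀ e → Follows (A (inj₂ e)) (node-at e))
      (node-at-antisym : ∀ {e e′} → node-at e ⊑ node-at e′ → node-at e′ ⊑ node-at e → e ≡ e′)
      (few : ¬ ((ℕ → Bool) ↣ E)) (b : ℕ → Set) (b-positive : Positive A b) where
      open Branches A ad W y ωω b b-positive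
      open Positivity A

      newBranch : ∃ λ f → ∀ e → ¬ node-of f ⊑ node-at e
      newBranch = byContradiction λ ¬∃ →
        let extended : ∀ f → ∃ λ e → node-of f ⊑ node-at e
            extended f = byContradiction λ ¬e → ¬∃ (f , λ e σ⊑ → ¬e (e , σ⊑))
        in few (mk↣ {to = proj₁ ∘ extended} λ {f} {g} eq → ext (common-extension⇒≡ f g
             (proj₂ (extended f)) (subst (λ e → node-of g ⊑ node-at e) (sym eq) (proj₂ (extended g)))))

      module _ (f : ℕ → Bool) (new : ∀ e → ¬ node-of f ⊑ node-at e) where

        k = proj₁ (node-of f)
        h = proj₂ (node-of f)

        cover : (j : Segment k) → ∃ λ L →
          Bounded (λ x → (limitSet f x × side (not (h (proj₁ j))) (y (proj₁ j)) x) × ¬ Covered A L x)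
        cover (j , j≺) = let n , j≺level = below-height f j≺ in ¬positive⇒bounded (limit-avoids f n j≺level)

        nth : List (ℕ ⊎ E) → ℕ → ℕ ⊎ E
        -- Past the end of the list any member will do, as a repeated condition is harmless.
        nth []      _       = inj₁ 0
        nth (i ∷ L) zero    = i
        nth (i ∷ L) (suc n) = nth L n

        nth-∈ : ∀ {i L} → i List.∈ L → ∃ λ n → nth L n ≡ i
        nth-∈ (here refl) = 0 , refl
        nth-∈ (there i∈L) = let n , eq = nth-∈ i∈L in suc n , eq

        -- The members that the new set must be explicitly made almost disjoint
        -- from; it is so from all others because their nodes disagree with the
        -- node of f.
        critical : Maybe (Segment k) × ℕ → ℕ ⊎ E
        critical (nothing , n)       = inj₁ n
        critical (just j , suc n)    = nth (proj₁ (cover j)) n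
        critical (just (j , _) , zero) with em {P = ∃ λ e → proj₁ (node-at e) ≡ j × node-at e ⊑ node-of f}
        ... | yes (e , _) = inj₂ e
        ... | no  _       = inj₁ 0

        -- One slot for each j suffices: two nodes of height j that are restrictions of the node of
        -- f extend each other, so their members coincide.
        critical-restriction : ∀ e → node-at e ⊑ node-of f → (k≺ : proj₁ (node-at e) ≺ k) →
          critical (just (proj₁ (node-at e) , k≺) , 0) ≡ inj₂ e
        critical-restriction e e⊑f k≺
          with em {P = ∃ λ e′ → proj₁ (node-at e′) ≡ proj₁ (node-at e) × node-at e′ ⊑ node-of f}
        ... | no ¬∃ = ⊥-elim (¬∃ (e , refl , e⊑f))
        ... | yes (e′ , eq , e′⊑f) = cong inj₂ (node-at-antisym
          (λ j j≺ → subst (j ≺_) eq j≺ , trans (proj₂ (e′⊑f j j≺)) (sym (proj₂ (e⊑f j (subst (j ≺_) eq j≺)))))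
          (λ j j≺ → subst (j ≺_) (sym eq) j≺ ,
                    trans (proj₂ (e⊑f j j≺)) (sym (proj₂ (e′⊑f j (subst (j ≺_) (sym eq) j≺))))))

        module _ (a : ℕ → Set) (a⊆e : ∀ {x} → a x → limitSet f x)
                 (a-ad : ∀ p → Bounded (λ x → a x × A (critical p) x)) where

          a-follows : Follows a (node-of f)
          a-follows j j≺ = let L , bd = cover (j , j≺) in
            bounded-from-cover L
              (bounded-⊆ (λ ((ax , yx) , ∉L) → (a⊆e ax , yx) , ∉L) bd)
              λ i∈L → let n , eq = nth-∈ i∈L in
                bounded-⊆ (λ ((ax , _) , Ax) → ax , Ax)
                  (subst (λ i → Bounded (λ x → a x × A i x)) eq (a-ad (just (j , j≺) , suc n)))

          ad-from-restriction : ∀ e → node-at e ⊑ node-of f → proj₁ (node-at e) ≺ k →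
                                Bounded (λ x → a x × A (inj₂ e) x)
          ad-from-restriction e e⊑f k≺ = subst (λ i → Bounded (λ x → a x × A i x))
            (critical-restriction e e⊑f k≺) (a-ad (just (_ , k≺) , 0))

          -- Nodes that disagree at some j put the two sets almost on opposite sides of y j.
          -- Otherwise the nodes are comparable; as no earlier node extends that of f, the earlier
          -- one is a proper restriction and is covered by `critical`.
          a-ad-all : ∀ i → Bounded (λ x → a x × A i x)
          a-ad-all (inj₁ n) = a-ad (nothing , n)
          a-ad-all (inj₂ e) = case em {P = ∃ λ j → j ≺ k × j ≺ k′ × h j ≢ h′ j} of λ where
              (yes (j , j≺k , j≺k′ , h≢h′)) →
                disagree⇒ad (node-of f) (node-at e) a-follows (follows e) j j≺k j≺k′ h≢h′
              (no ¬∃) →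
                let agree : ∀ {j} → j ≺ k → j ≺ k′ → h j ≡ h′ j
                    agree j≺k j≺k′ = byContradiction λ h≢h′ → ¬∃ (_ , j≺k , j≺k′ , h≢h′)
                in case ≺-compare k′ k of λ where
                  (inj₁ k′≺k) → ad-from-restriction e
                    (λ j j≺k′ → ≺-trans j≺k′ k′≺k , sym (agree (≺-trans j≺k′ k′≺k) j≺k′)) k′≺k
                  (inj₂ (inj₁ k′≡k)) → ⊥-elim (new e λ j j≺k →
                    subst (j ≺_) (sym k′≡k) j≺k , agree j≺k (subst (j ≺_) (sym k′≡k) j≺k))
                  (inj₂ (inj₂ k≺k′)) → ⊥-elim (new e λ j j≺k →
                    ≺-trans j≺k k≺k′ , agree j≺k (≺-trans j≺k k≺k′))
            where
            k′ = proj₁ (node-at e)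
            h′ = proj₂ (node-at e)

      extend : ∃ λ (a : ℕ → Set) → ∃ λ (σ : Node) → Unbounded a × (∀ {x} → a x → b x) ×
        Follows a σ × (∀ i → Bounded (λ x → a x × A i x)) × ∀ e → ¬ σ ⊑ node-at e
      extend =
        let f , new = newBranch
            _ , e-positive , e⊆b , _ = limit f
            a , a-unbounded , a⊆e , a-ad = avoid is𝔞 A ad (critical f new) (narrow _) (limitSet f) e-positive
        in a , node-of f , a-unbounded , e⊆b ∘ a⊆e ,
           a-follows f new a a⊆e a-ad , a-ad-all f new a a⊆e a-ad , new


  -- The transfinite recursion

  -- The recursion takes some good value and falls back on v₀ if there is none; only afterwards does
  -- induction through `step` show that the fallback never occurs.
  transfiniteChoice : {D V : Set} (W : WellOrder D)
    (Good : (δ : D) → (WellOrder.Segment W δ → V) → V → Set) → V →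
    (∀ δ (f : D → V) → (∀ γ → WellOrder._≺_ W γ δ → Good γ (f ∘ proj₁) (f γ)) →
      ∃ λ v → Good δ (f ∘ proj₁) v) →
    ∃ λ (f : D → V) → ∀ δ → Good δ (f ∘ proj₁) (f δ)
  transfiniteChoice {D} {V} W Good v₀ step = f , λ δ → good (≺-wellFounded δ)
    where
    open WellOrder W
    choose : ∀ δ → (Segment δ → V) → V
    choose δ prev with em {P = ∃ (Good δ prev)}
    ... | yes (v , _) = v
    ... | no  _       = v₀
    choose-good : ∀ δ prev → ∃ (Good δ prev) → Good δ prev (choose δ prev)
    choose-good δ prev ∃v with em {P = ∃ (Good δ prev)}
    ... | yes (_ , good) = good
    ... | no  ¬∃         = ⊥-elim (¬∃ ∃v)
    body : ∀ δ → (∀ {γ} → γ ≺ δ → V) → V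
    body δ rec = choose δ λ (_ , γ≺δ) → rec γ≺δ
    f : D → V
    f = WF.All.wfRec ≺-wellFounded _ (λ _ → V) body
    f-unfold : ∀ δ → f δ ≡ choose δ (f ∘ proj₁)
    f-unfold δ = WF.FixPoint.unfold-wfRec ≺-wellFounded (λ _ → V) body
      (λ γ eq → cong (choose γ) (ext λ (_ , β≺γ) → eq β≺γ))
    good : ∀ {δ} → Acc _≺_ δ → Good δ (f ∘ proj₁) (f δ)
    good {δ} (acc rs) = subst (Good δ (f ∘ proj₁)) (sym (f-unfold δ))
      (choose-good δ (f ∘ proj₁) (step δ f λ γ γ≺δ → good (rs γ≺δ)))

  -- An initial ordinal for X: the whole well-order if no segment contains a copy of X, else the
  -- segment below the least u for which one does.
  minimalEnumeration : (X : Set) → X → ∃ λ (D : Set) → Σ (WellOrder D) λ W →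
    (∀ δ → ¬ (X ↣ WellOrder.Segment W δ)) × ∃ λ (enum : D → X) → ∀ x → ∃ λ δ → enum δ ≡ x
  minimalEnumeration X x₀ = case em {P = ∃ λ u → X ↣ Segment u} of λ where
      (no ¬∃) → X , W , (λ u f → ¬∃ (u , f)) , id , λ x → x , refl
      (yes ∃u) → let u , f , minimal = least W (λ u → X ↣ Segment u) ∃u in
        Segment u , segmentOrder W u ,
        (λ (v , v≺u) g → minimal v v≺u (↣-trans g
          (mk↣ {to = λ ((w , _) , w≺v) → w , w≺v} λ eq → Element-≡ (Element-≡ (cong proj₁ eq))))) ,
        inverse f , λ x → Injection.to f x , inverse-to f x
    where
    W = Zermelo.wellOrder X
    open WellOrder W
    inverse : X ↣ Y → Y → X
    inverse f y with em {P = ∃ λ x → Injection.to f x ≡ y}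
    ... | yes (x , _) = x
    ... | no  _       = x₀
    inverse-to : (f : X ↣ Y) → ∀ x → inverse f (Injection.to f x) ≡ x
    inverse-to f x with em {P = ∃ λ x′ → Injection.to f x′ ≡ Injection.to f x}
    ... | yes (_ , eq) = Injection.injective f eq
    ... | no  ¬∃       = ⊥-elim (¬∃ (x , refl))

  module Construction {𝔞 D : Set} (is𝔞 : Is𝔞 𝔞) (W : WellOrder K) (narrow : NarrowOrder 𝔞 W)
    (y : K → ℕ → Set) (ωω : ωωSplittingPredicates y)
    (base : ℕ → 𝒫 ℕ) (base-unbounded : ∀ n → Unbounded (_∈ base n))
    (base-ad : PairwiseAD λ n x → x ∈ base n)
    (V : WellOrder D) (few : ∀ δ → ¬ ((ℕ → Bool) ↣ WellOrder.Segment V δ))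
    (enum : D → 𝒫 ℕ) (enum-surjective : ∀ s → ∃ λ δ → enum δ ≡ s) where
    open WellOrder V
    open Nodes W
    open Extension is𝔞 W narrow y ωω using (Follows; extend)

    members : {E : Set} → (E → 𝒫 ℕ × Node) → ℕ ⊎ E → 𝒫 ℕ
    members f (inj₁ n) = base n
    members f (inj₂ e) = proj₁ (f e)

    family : {E : Set} → (E → 𝒫 ℕ × Node) → ℕ ⊎ E → ℕ → Set
    family f i x = x ∈ members f i

    Good : (δ : D) → (Segment δ → 𝒫 ℕ × Node) → 𝒫 ℕ × Node → Set
    Good δ f (a , σ) = Unbounded (_∈ a) × Follows (_∈ a) σ ×
      (∀ i → Bounded (λ x → x ∈ a × family f i x)) × (∀ γ → ¬ σ ⊑ proj₂ (f γ)) ×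
      (Positive (family f) (_∈ enum δ) → a ⊆ enum δ)

    positive-base : ∀ {E} (f : E → 𝒫 ℕ × Node) → PairwiseAD (family f) → Positive (family f) (λ _ → ⊤)
    positive-base f ad = Positivity.positive-if-sequence (family f) ad {σ = inj₁} (λ { refl → refl })
      λ N → N , ≤-refl , unbounded-⊆ (tt ,_) (base-unbounded N)

    -- Used with ι = `proj₁` for the members before a stage and with ι = `id` for the complete
    -- family.
    module _ {E : Set} (ι : E → D) (ι-injective : Injective _≡_ _≡_ ι) (f : D → 𝒫 ℕ × Node)
             (good : ∀ e → Good (ι e) (f ∘ proj₁) (f (ι e))) where

      later-ad : ∀ d e → ι d ≺ ι e → Bounded (λ x → x ∈ proj₁ (f (ι e)) × x ∈ proj₁ (f (ι d)))
      later-ad d e d≺e = let _ , _ , ad , _ = good e in ad (inj₂ (ι d , d≺e))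

      family-ad : PairwiseAD (family (f ∘ ι))
      family-ad {inj₁ m} {inj₁ n} m≢n = base-ad (m≢n ∘ cong inj₁)
      family-ad {inj₁ m} {inj₂ e} _ = let _ , _ , ad , _ = good e in bounded-⊆ swap (ad (inj₁ m))
      family-ad {inj₂ e} {inj₁ n} _ = let _ , _ , ad , _ = good e in ad (inj₁ n)
      family-ad {inj₂ d} {inj₂ e} d≢e = case ≺-compare (ι d) (ι e) of λ where
        (inj₁ d≺e)        → bounded-⊆ swap (later-ad d e d≺e)
        (inj₂ (inj₁ d≡e)) → ⊥-elim (d≢e (cong inj₂ (ι-injective d≡e)))
        (inj₂ (inj₂ e≺d)) → later-ad e d e≺d

      nodes-antisym : ∀ {d e} → proj₂ (f (ι d)) ⊑ proj₂ (f (ι e)) → proj₂ (f (ι e)) ⊑ proj₂ (f (ι d)) → d ≡ e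
      nodes-antisym {d} {e} d⊑e e⊑d = case ≺-compare (ι d) (ι e) of λ where
        (inj₁ d≺e)        → let _ , _ , _ , new , _ = good e in ⊥-elim (new (ι d , d≺e) e⊑d)
        (inj₂ (inj₁ d≡e)) → ι-injective d≡e
        (inj₂ (inj₂ e≺d)) → let _ , _ , _ , new , _ = good d in ⊥-elim (new (ι e , e≺d) d⊑e)

    step : ∀ δ (f : D → 𝒫 ℕ × Node) → (∀ γ → γ ≺ δ → Good γ (f ∘ proj₁) (f γ)) →
           ∃ λ v → Good δ (f ∘ proj₁) v
    step δ f good =
      let b , b-positive , b⊆enum = target
          a , σ , a-unbounded , a⊆b , follows , a-ad , new =
            extend A ad (proj₂ ∘ f ∘ proj₁) (λ (γ , γ≺δ) → proj₁ (proj₂ (good γ γ≺δ)))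
              (nodes-antisym proj₁ Element-≡ f good′) (few δ) b b-positive
      in (⟦ a ⟧ , σ) , unbounded-⊆ ∈-intro a-unbounded ,
         (λ j j≺ → bounded-⊆ (λ (x∈a , yx) → ∈-elim x∈a , yx) (follows j j≺)) ,
         (λ i → bounded-⊆ (λ (x∈a , Ax) → ∈-elim x∈a , Ax) (a-ad i)) , new ,
         λ pos x∈a → b⊆enum pos _ (a⊆b (∈-elim x∈a))
      where
      good′ : (γ : Segment δ) → Good (proj₁ γ) (f ∘ proj₁) (f (proj₁ γ))
      good′ (γ , γ≺δ) = good γ γ≺δ
      A = family {Segment δ} (f ∘ proj₁)
      ad : PairwiseAD A
      ad = family-ad proj₁ Element-≡ f good′
      target : ∃ λ (b : ℕ → Set) → Positive A b × (Positive A (_∈ enum δ) → ∀ x → b x → x ∈ enum δ)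
      target = case em {P = Positive A (_∈ enum δ)} of λ where
        (yes pos) → (_∈ enum δ) , pos , λ _ _ → id
        -- Nothing is required of this stage, but it still adds a member; the infinitely many base
        -- sets make ω a positive set to choose it from.
        (no ¬pos) → (λ _ → ⊤) , positive-base (f ∘ proj₁) ad , λ pos → ⊥-elim (¬pos pos)

    abstract
      recursion : ∃ λ (f : D → 𝒫 ℕ × Node) → ∀ δ → Good δ (f ∘ proj₁) (f δ)
      recursion = transfiniteChoice V Good (base 0 , node₀ , λ _ → false) step
        where
        node₀ : K
        node₀ = proj₁ (ωω (λ _ _ → ⊤) (λ _ N → N , ≤-refl , tt))

    final : D → 𝒫 ℕ × Node
    final = proj₁ recursion

    𝒜 : Family
    𝒜 = ⟦ (λ s → ∃ λ i → members final i ≡ s) ⟧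

    members∈𝒜 : ∀ i → members final i ∈ 𝒜
    members∈𝒜 i = ∈-intro (i , refl)

    final-ad : PairwiseAD (family final)
    final-ad = family-ad id id final (proj₂ recursion)

    members-unbounded : ∀ i → Unbounded (family final i)
    members-unbounded (inj₁ n) = base-unbounded n
    members-unbounded (inj₂ δ) = proj₁ (proj₂ recursion δ)

    𝒜-ad : AlmostDisjoint 𝒜
    𝒜-ad = (λ s∈𝒜 → let i , eq = ∈-elim s∈𝒜 in
              subst Infinite eq (unbounded⇒infinite (members-unbounded i))) ,
           λ s∈𝒜 t∈𝒜 s≢t → let i , eq  = ∈-elim s∈𝒜
                               j , eq′ = ∈-elim t∈𝒜 in
             subst₂ (λ s t → Finite (s ∩ t)) eq eq′ (finite-∩⁺ (members final i) (members final j)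
               (final-ad {i} {j} λ i≡j → s≢t (trans (sym eq) (trans (cong (members final) i≡j) eq′))))

    𝒜-infinite : Infinite 𝒜
    𝒜-infinite (L , complete) =
      let N , ∉L = eventually-∉ {σ = base} base-injective L
      in ∉L N ≤-refl (complete (members∈𝒜 (inj₁ N)))
      where
      base-injective : Injective _≡_ _≡_ base
      base-injective {m} {n} eq = byContradiction λ m≢n → unbounded⇒¬bounded (base-unbounded m)
        (bounded-⊆ (λ {x} x∈ → x∈ , subst (x ∈_) eq x∈) (base-ad m≢n))

    positive-initially : ∀ δ {P} → Positive (family final) P → Positive (family {Segment δ} (final ∘ proj₁)) P
    positive-initially δ pos L = unbounded-⊆
      (λ (Px , ¬cov) → Px , λ cov → ¬cov (map⁺ (Any.map (λ {i} → include i) cov)))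
      (pos (List.map (map₂ proj₁) L))
      where
      include : ∀ i {x} → family {Segment δ} (final ∘ proj₁) i x → family final (map₂ proj₁ i) x
      include (inj₁ _) = id
      include (inj₂ _) = id

    contains-member : ∀ t → Positive (family final) (_∈ t) → ∃ λ i → members final i ⊆ t
    contains-member t pos =
      let δ , δ≡t = enum-surjective t
          _ , _ , _ , _ , final⊆ = proj₂ recursion δ
      in inj₂ δ , subst (members final (inj₂ δ) ⊆_) δ≡t
           (final⊆ (positive-initially δ (subst (λ t → Positive (family final) (_∈ t)) (sym δ≡t) pos)))

    -- An infinite set almost disjoint from all members is positive, so it contains a member and
    -- meets that one in an infinite set.
    𝒜-maximal : MaximalAlmostDisjoint 𝒜
    𝒜-maximal = 𝒜-infinite , 𝒜-ad , λ (ℬ , (ℬ-infinite , ℬ-ad) , 𝒜⊆ℬ , ℬ⊈𝒜) →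
      ℬ⊈𝒜 λ {t} t∈ℬ → byContradiction λ t∉𝒜 →
        let t-ad : ∀ i → Bounded (λ x → x ∈ t × family final i x)
            t-ad i = finite-∩⁻ t (members final i) (ℬ-ad t∈ℬ (𝒜⊆ℬ (members∈𝒜 i))
              λ eq → t∉𝒜 (subst (_∈ 𝒜) (sym eq) (members∈𝒜 i)))
            i , i⊆t = contains-member t (Positivity.positive-if-ad (family final)
              (infinite⇒unbounded (ℬ-infinite t∈ℬ)) t-ad)
        in unbounded⇒¬bounded (members-unbounded i) (bounded-⊆ (λ x∈ → i⊆t x∈ , x∈) (t-ad i))

    covered⇒∈union : ∀ s L {x} → x ∈ s ⊎ Covered (family final) L x →
                     x ∈ foldr₁ _∪_ (s ∷ List.map (members final) L)
    covered⇒∈union s []      (inj₁ x∈s)          = x∈s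
    covered⇒∈union s (i ∷ L) (inj₁ x∈s)          = Equivalence.from (T-∨ {s _}) (inj₁ x∈s)
    covered⇒∈union s (i ∷ L) (inj₂ (here x∈))    = Equivalence.from (T-∨ {s _}) (inj₂ (covered⇒∈union _ L (inj₁ x∈)))
    covered⇒∈union s (i ∷ L) (inj₂ (there cov))  = Equivalence.from (T-∨ {s _}) (inj₂ (covered⇒∈union _ L (inj₂ cov)))

    ℐ⁺⇒positive : ∀ {t} → t ∈ℐ⁺ 𝒜 → Positive (family final) (_∈ t)
    ℐ⁺⇒positive {t} t∈ℐ⁺ L = ¬bounded⇒unbounded λ b → t∈ℐ⁺
      -- L may be empty, whereas `_∈ℐ_` needs a non-empty list; `base 0` fills the gap.
      ( base 0 ∷ List.map (members final) L
      , members∈𝒜 (inj₁ 0) ∷ All-map⁺ (All.universal members∈𝒜 L)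
      , bounded⇒finite (bounded-⊆ (λ x∈ →
          let x∈t , x∉ = ∈-∖⁻ t (foldr₁ _∪_ (base 0 ∷ List.map (members final) L)) x∈ in
          x∈t , λ cov → x∉ (covered⇒∈union (base 0) L (inj₂ cov))) b))

    𝒜-completelySeparable : CompletelySeparable 𝒜
    𝒜-completelySeparable = 𝒜-ad , λ t t∈ℐ⁺ →
      let i , i⊆t = contains-member t (ℐ⁺⇒positive t∈ℐ⁺) in members final i , members∈𝒜 i , i⊆t


  -- From the cardinal invariants to the construction

  splitting⇒predicates : ∀ {ℱ} {X : Set} → Splitting ℱ → Elements ℱ ↔ X →
                         ∃ λ (y : X → ℕ → Set) → SplittingPredicates y
  splitting⇒predicates {ℱ} {X} splitting ℱ↔X = y , λ s u →
    let t , t∈ℱ , meets , misses = splitting ⟦ s ⟧ (unbounded⇒infinite (unbounded-⊆ ∈-intro u))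
        t≡ = cong proj₁ (strictlyInverseʳ (t , t∈ℱ))
    in to (t , t∈ℱ) , λ where
      true  → unbounded-⊆ (λ {x} x∈ → let x∈s , x∈t = ∈-∩⁻ ⟦ s ⟧ t x∈ in
                ∈-elim x∈s , subst (x ∈_) (sym t≡) x∈t) (infinite⇒unbounded meets)
      false → unbounded-⊆ (λ {x} x∈ → let x∈s , x∉t = ∈-∖⁻ ⟦ s ⟧ t x∈ in
                ∈-elim x∈s , λ x∈ → x∉t (subst (x ∈_) t≡ x∈)) (infinite⇒unbounded misses)
    where
    open Inverse ℱ↔X
    y : X → ℕ → Set
    y k x = x ∈ proj₁ (from k)

  completelySeparableMAD : (𝔰 𝔞 : Set) → Is𝔰 𝔰 → Is𝔞 𝔞 → 𝔰 ↣ 𝔞 →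
    ∃ λ (𝒜 : Family) → MaximalAlmostDisjoint 𝒜 × CompletelySeparable 𝒜
  completelySeparableMAD 𝔰 𝔞 ((_ , splitting , 𝒮↔𝔰) , _)
                         is𝔞@((ℱ , mad@(ℱ-infinite , ℱ-ad , _) , ℱ↔𝔞) , _) 𝔰≤𝔞 =
    let y , y-splits = splitting⇒predicates splitting 𝒮↔𝔰
        K , W , narrow , z , ωω = narrowωωSplitting y-splits 𝔰≤𝔞 λ 𝔞↣Tree →
          mad-uncountable mad (countable-↣ (↣-trans (↔⇒↣ ℱ↔𝔞) 𝔞↣Tree) tree-countable)
        -- Any infinite almost disjoint sequence can serve as the base; the MAD family that
        -- witnesses 𝔞 supplies one.
        σ , σ-injective , _ = injectiveSequence (infinite⇒¬finitely ℱ-infinite)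
        D , V , few , enum , enum-surjective = minimalEnumeration (𝒫 ℕ) (λ _ → false)
        open Construction is𝔞 W narrow z ωω (proj₁ ∘ σ)
          (λ n → infinite⇒unbounded (proj₁ ℱ-ad (proj₂ (σ n))))
          (λ m≢n → elements-ad ℱ-ad (m≢n ∘ σ-injective))
          V few enum enum-surjective
    in 𝒜 , 𝒜-maximal , 𝒜-completelySeparable

theorem10 : (∀ {ℓ} → ExcludedMiddle ℓ) →
    (∀ {ℓ₁ ℓ₂} → Extensionality ℓ₁ ℓ₂) →
    (𝔰 𝔞 : Set) → Is𝔰 𝔰 → Is𝔞 𝔞 →
    𝔰 ↣ 𝔞 →
    ∃ λ (𝒜 : Family) → MaximalAlmostDisjoint 𝒜 × CompletelySeparable 𝒜
theorem10 em ext = completelySeparableMAD em ext
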